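{- Let $n \geq 2$ and let $A$ be a cyclic permutation group of order $2^n$ on a finite set. For $i \in \{1,\ldots,n\}$ let $k_i$ denote the number of orbits of $A$ of cardinality $2^i$. Then: (1) if $\sum_{i=2}^n k_i = 1$, then $A \notin GR$; (2) if $\sum_{i=2}^n k_i = 2$, $k_1 = 0$ and $k_2 \in \{1,2\}$, then $A \in GR^*(3)$; (3) otherwise, $A \in GR(2)$.
   Context: A cyclic permutation group is a permutation group generated by a single permutation; its order is the number of its elements. A $k$-colored graph $G=(V,E)$ consists of a finite set $V$ and a function $E$ from the 2-element subsets of $V$ to $\{0,\ldots,k-1\}$. An automorphism of $G$ is a permutation of $V$ preserving $E$; $Aut(G)$ is the automorphism group as a permutation group on $V$. $GR(k)$ is the class of permutation groups $(A,V)$ with $A=Aut(G)$ for some $k$-colored graph $G$ on $V$; $GR=\bigcup_k GR(k)$; $GR^*(k)=GR(k)\setminus GR(k-1)$. -}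

module Defs where

open import Data.Nat using (ℕ; zero; suc; _+_; _<_; _≤_; _^_)
open import Data.Fin using (Fin; toℕ; _≟_)
open import Data.Fin.Permutation using (Permutation′; _⟨$⟩ʳ_)
open import Data.List using (List; length; filterᵇ; allFin; upTo)
open import Data.Bool.ListAction using (any; all)
open import Data.Bool using (Bool; _∧_; if_then_else_)
open import Data.Product using (Σ; ∃; _×_)
open import Relation.Nullary using (¬_; does)
open import Relation.Binary.PropositionalEquality using (_≡_; _≢_)
open import Data.Nat using (_≤ᵇ_)

private variable m : ℕ

pow : Permutation′ m → ℕ → Fin m → Fin m
pow σ zero    x = x
pow σ (suc j) x = σ ⟨$⟩ʳ (pow σ j x)

IsPower : Permutation′ m → ℕ → Permutation′ m → Set
IsPower σ j π = ∀ x → π ⟨$⟩ʳ x ≡ pow σ j x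

IsIdPower : Permutation′ m → ℕ → Set
IsIdPower σ j = ∀ x → pow σ j x ≡ x

⟨_⟩ : Permutation′ m → Permutation′ m → Set
⟨ σ ⟩ π = ∃ λ j → IsPower σ j π

CyclicOfOrder : Permutation′ m → ℕ → Set
CyclicOfOrder σ t = (0 < t) × IsIdPower σ t × (∀ s → 0 < s → s < t → ¬ IsIdPower σ s)

PermGroup : ℕ → Set₁
PermGroup m = Permutation′ m → Set

-- k-colored graph on Fin m: a colouring of the 2-element subsets {x,y} (x ≢ y).
-- Represented by a function on ordered pairs that is symmetric; its values on
-- the diagonal x = y are ignored everywhere.
record ColoredGraph (k m : ℕ) : Set where
  field
    E    : Fin m → Fin m → Fin k
    symm : ∀ x y → E x y ≡ E y x
open ColoredGraph public

IsAut : ∀ {k} → ColoredGraph k m → Permutation′ m → Set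
IsAut G π = ∀ x y → x ≢ y → E G (π ⟨$⟩ʳ x) (π ⟨$⟩ʳ y) ≡ E G x y

IsAutGroupOf : ∀ {k} → PermGroup m → ColoredGraph k m → Set
IsAutGroupOf A G = ∀ π → (A π → IsAut G π) × (IsAut G π → A π)

GR : ℕ → PermGroup m → Set
GR {m} k A = Σ (ColoredGraph k m) λ G → IsAutGroupOf A G

GRany : PermGroup m → Set
GRany A = ∃ λ k → GR k A

GR* : ℕ → PermGroup m → Set
GR* zero    A = GR zero A
GR* (suc k) A = GR (suc k) A × ¬ GR k A

-- Orbits of ⟨σ⟩ when σ^N = id: the orbit of x is {σ^j x | j < N}
-- (which equals {σ^j x | j ∈ ℕ} since σ^N = id).
inOrbitᵇ : ℕ → Permutation′ m → Fin m → Fin m → Bool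
inOrbitᵇ N σ x y = any (λ j → does (pow σ j x ≟ y)) (upTo N)

orbit : ℕ → Permutation′ m → Fin m → List (Fin m)
orbit {m} N σ x = filterᵇ (inOrbitᵇ N σ x) (allFin m)

isRepᵇ : ℕ → Permutation′ m → Fin m → Bool
isRepᵇ N σ x = all (λ y → toℕ x ≤ᵇ toℕ y) (orbit N σ x)

numOrbitsOfSize : ℕ → Permutation′ m → ℕ → ℕ
numOrbitsOfSize {m} N σ s =
  length (filterᵇ (λ x → isRepᵇ N σ x ∧ does (length (orbit N σ x) Data.Nat.≟ s)) (allFin m))

sumFromTo : ℕ → ℕ → (ℕ → ℕ) → ℕ
sumFromTo a zero    f = if a ≤ᵇ 0 then f 0 else 0
sumFromTo a (suc b) f = sumFromTo a b f + (if a ≤ᵇ suc b then f (suc b) else 0)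

{-# OPTIONS --safe #-}
module Submission where

open import Defs
open import Algebra.Properties.CommutativeSemigroup using (interchange)
open import Data.Bool using (true; false; T; _∧_; if_then_else_)
open import Data.Bool.Properties using (T?; if-eta)
open import Data.Empty using (⊥; ⊥-elim)
open import Data.Fin using (Fin; zero; suc; toℕ)
import Data.Fin.Properties as Fin
open import Data.Fin.Permutation using (Permutation′; permutation; _⟨$⟩ʳ_; _⟨$⟩ˡ_; inverseˡ; inverseʳ)
open import Data.List using (List; []; _∷_; length; filter; filterᵇ; allFin; upTo; applyUpTo)
open import Data.List.Membership.DecPropositional using (_∈?_)
open import Data.List.Membership.Propositional using (_∈_; find; lose)
open import Data.List.Membership.Propositional.Properties using (∈-allFin; ∈-filter⁺; ∈-filter⁻; ∈-applyUpTo⁺; ∈-applyUpTo⁻; ∈-upTo⁺)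
open import Data.List.Membership.Propositional.Properties.WithK using (unique∧set⇒bag)
open import Data.List.Properties using (length-applyUpTo; filter-accept; filter-reject; filter-none; filter-some)
open import Data.List.Relation.Binary.BagAndSetEquality using (∼bag⇒↭)
open import Data.List.Relation.Binary.Permutation.Propositional using (↭-sym; ↭⇒↭ₛ)
open import Data.List.Relation.Binary.Permutation.Propositional.Properties using (↭-length; filter-↭; Any-resp-↭)
import Data.List.Relation.Binary.Permutation.Setoid.Properties as Permutationₛ
open import Data.List.Relation.Unary.All as All using (All; []; _∷_)
open import Data.List.Relation.Unary.All.Properties using (all⁺; all⁻; all-filter)
open import Data.List.Relation.Unary.AllPairs as AllPairs using (AllPairs; []; _∷_)
open import Data.List.Relation.Unary.Any using (Any; here; there; index)
open import Data.List.Relation.Unary.Any.Properties using (any⁺; any⁻)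
open import Data.List.Relation.Unary.Sorted.TotalOrder.Properties using (Sorted⇒AllPairs)
open import Data.List.Relation.Unary.Unique.Propositional using (Unique)
open import Data.List.Relation.Unary.Unique.Propositional.Properties using (allFin⁺; filter⁺; applyUpTo⁺₁)
import Data.List.Sort as Sort
open import Data.Maybe using (Maybe; just; nothing)
open import Data.Maybe.Properties using (just-injective; ≡-dec)
open import Data.Nat using (ℕ; zero; suc; _+_; _*_; _∸_; _^_; _≤_; _<_; z≤n; s≤s; z<s; s<s; _≤?_; _<?_; _≤ᵇ_; ∣_-_∣; NonZero; pred; >-nonZero)
import Data.Nat as ℕ
open import Data.Nat.Coprimality using (Coprime; coprime-divisor)
open import Data.Nat.Divisibility using (_∣_; divides; _∣?_; ∣-trans; ∣1⇒≡1; *-cancelʳ-∣; m%n≡0⇒n∣m; >⇒∤)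
open import Data.Nat.DivMod using (_%_; _/_; m≡m%n+[m/n]*n; m%n<n)
open import Data.Nat.Induction using (<-wellFounded)
open import Data.Nat.Primality using (prime[2]; prime⇒irreducible)
open import Data.Nat.Properties
open import Data.Nat.Tactic.RingSolver using (solve-∀)
open import Data.Product using (∃; _×_; _,_; proj₁; proj₂)
open import Data.Sum as Sum using (_⊎_; inj₁; inj₂; swap)
open import Function using (_∘_; case_of_; mk⇔)
open import Induction.WellFounded using (Acc; acc)
open import Relation.Binary using (DecidableEquality; DecTotalOrder; tri<; tri≈; tri>)
import Relation.Binary.Construct.Flip.EqAndOrd as Flip
import Relation.Binary.Construct.On as On
open import Relation.Binary.PropositionalEquality
open import Relation.Nullary
open import Relation.Nullary.Decidable using (_×-dec_; _⊎-dec_; _→-dec_; ¬?; from-no; from-yes; dec-true; dec-false; does-⇔; decidable-stable)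
open import Relation.Unary using (Decidable)

-- Order the orbits by decreasing size; their sizes are powers of 2, so each orbit maps
-- equivariantly onto the next, v ↦ p v. A graph realises A if its automorphisms preserve the
-- first orbit X and those fixing a point of X are trivial.
-- With at least three nontrivial orbits X, Y, Z, ..., of which X and Y have size at least 4, take
-- the edges v — p v, x — σ x on X, z — σ z on Z, and for x ∈ X also x — p (p x) and x — σ⁻¹ (p x).
-- The edges x — p x, σ⁻¹ (p x) alone admit a reflection, but it swaps parities on exactly one of X
-- and Y, which Z detects.
-- With only X and Y, both of size at least 8, take x — σ x, y — σ⁴ y, and join x to σ⁻ⁱ (p x) for
-- i ∈ {0, 1, 3}, a set without reflections. If |Y| = 4, three colours are needed, because every
-- subset of ℤ/4 has a reflection. When all orbits but X have size at most 2, reflecting X alone is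
-- an automorphism of every graph with automorphism σ.
-- Fixed points can be added at will, joined to everything or to nothing.

-- What has to be destroyed are reflections. The colour of two vertices `σⁱ a`, `σʲ a` of one orbit
-- depends on ±(i - j) only, so `i ↦ −i` preserves all colours inside every orbit, whatever the
-- graph, even after a shift chosen separately for each orbit. Asymmetry can only come from the
-- colours between two orbits, a function of the difference of exponents modulo the smaller size.
-- For size at most 2 such a function is even; for size 4 and two colours it has an axis; three
-- colours, or size 8, allow a function without one. With a third orbit, the axes for the various
-- pairs of orbits need not be compatible. On the constructive side no colour names an orbit, so the
-- first orbit has to be recognised from the graph itself: with two colours by the triangles through
-- a vertex, with three colours by the number of neighbours in one colour.

-- Powers of a permutation

module Powers {m : ℕ} (σ : Permutation′ m) where

  s : Fin m → Fin m
  s x = σ ⟨$⟩ʳ x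

  s-injective : ∀ {x y} → s x ≡ s y → x ≡ y
  s-injective {x} {y} e = trans (sym (inverseˡ σ)) (trans (cong (σ ⟨$⟩ˡ_) e) (inverseˡ σ))

  s-surjective : ∀ x → ∃ λ a → x ≡ s a
  s-surjective x = σ ⟨$⟩ˡ x , sym (inverseʳ σ)

  pow-+ : ∀ i j x → pow σ (i + j) x ≡ pow σ i (pow σ j x)
  pow-+ zero    j x = refl
  pow-+ (suc i) j x = cong s (pow-+ i j x)

  pow-comm : ∀ i j x → pow σ i (pow σ j x) ≡ pow σ j (pow σ i x)
  pow-comm i j x = trans (sym (pow-+ i j x)) (trans (cong (λ t → pow σ t x) (+-comm i j)) (pow-+ j i x))

  pow-injective : ∀ i {x y} → pow σ i x ≡ pow σ i y → x ≡ y
  pow-injective zero    e = e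
  pow-injective (suc i) e = pow-injective i (s-injective e)

  pow-*-cong : ∀ k {i j x} → pow σ i x ≡ pow σ j x → pow σ (k * i) x ≡ pow σ (k * j) x
  pow-*-cong zero    e = refl
  pow-*-cong (suc k) {i} {j} {x} e = begin
    pow σ (i + k * i) x       ≡⟨ pow-+ i (k * i) x ⟩
    pow σ i (pow σ (k * i) x) ≡⟨ cong (pow σ i) (pow-*-cong k e) ⟩
    pow σ i (pow σ (k * j) x) ≡⟨ pow-comm i (k * j) x ⟩
    pow σ (k * j) (pow σ i x) ≡⟨ cong (pow σ (k * j)) e ⟩
    pow σ (k * j) (pow σ j x) ≡⟨ pow-comm (k * j) j x ⟩
    pow σ j (pow σ (k * j) x) ≡⟨ pow-+ j (k * j) x ⟨
    pow σ (j + k * j) x       ∎ where open ≡-Reasoning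

  pow-*-fix : ∀ k {i x} → pow σ i x ≡ x → pow σ (k * i) x ≡ x
  pow-*-fix k {i} {x} e = trans (pow-*-cong k {i} {0} e) (cong (λ t → pow σ t x) (*-zeroʳ k))

  fixed-pow : ∀ {f} → s f ≡ f → ∀ t → pow σ t f ≡ f
  fixed-pow sf zero    = refl
  fixed-pow sf (suc t) = trans (cong s (fixed-pow sf t)) sf

  -- Cancelling `s` on both sides leaves one exponent 0; the distance avoids deciding which exponent
  -- is larger.
  residue : ∀ {d y} → (∀ k → pow σ k y ≡ y → d ∣ k) → ∀ a b → pow σ a y ≡ pow σ b y → d ∣ ∣ a - b ∣
  residue multiple zero    b       e = multiple b (sym e)
  residue multiple (suc a) zero    e = multiple (suc a) e
  residue multiple (suc a) (suc b) e = residue multiple a b (s-injective e)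

  module _ {C : Set} {f : Fin m → Fin m → C} (f-s : ∀ u v → f (s u) (s v) ≡ f u v) where

    pow-invariant : ∀ t u v → f (pow σ t u) (pow σ t v) ≡ f u v
    pow-invariant zero    u v = refl
    pow-invariant (suc t) u v = trans (f-s _ _) (pow-invariant t u v)

-- Graphs that are rigid on a set of vertices

-- The maps permute all vertices and stabilise `U`, so passing to a smaller stabilised set leaves
-- them as they are.
record LocalAut {m : ℕ} {C : Set} (E : Fin m → Fin m → C) (U : Fin m → Set) : Set where
  field
    to from   : Fin m → Fin m
    to∘from   : ∀ v → to (from v) ≡ v
    from∘to   : ∀ v → from (to v) ≡ v
    to-U      : ∀ {v} → U v → U (to v)
    from-U    : ∀ {v} → U v → U (from v)
    preserves : ∀ {u v} → U u → U v → u ≢ v → E (to u) (to v) ≡ E u v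

  to-injective : ∀ {u v} → to u ≡ to v → u ≡ v
  to-injective {u} {v} e = trans (sym (from∘to u)) (trans (cong from e) (from∘to v))

-- If `U` contains every vertex, the graph realises the group generated by `σ`: `invariant` gives
-- one inclusion, `rigid` the other.
record Rigid {m : ℕ} (σ : Permutation′ m) (k : ℕ) (U : Fin m → Set) : Set where
  field
    edge         : Fin m → Fin m → Fin k
    symmetric : ∀ u v → edge u v ≡ edge v u
    invariant : ∀ u v → edge (σ ⟨$⟩ʳ u) (σ ⟨$⟩ʳ v) ≡ edge u v
    rigid     : (φ : LocalAut edge U) → ∃ λ t → ∀ v → U v → LocalAut.to φ v ≡ pow σ t v

-- Adding fixed points

module Extension {m : ℕ} (σ : Permutation′ m) (k : ℕ) where
  open Powers σ

  resp-⇔ : {U W : Fin m → Set} → (∀ {v} → U v → W v) → (∀ {v} → W v → U v) → Rigid σ k U → Rigid σ k W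
  resp-⇔ U⇒W W⇒U R = record
    { edge = edge ; symmetric = symmetric ; invariant = invariant
    ; rigid = λ φ → let open LocalAut φ
                        (t , eq) = rigid (record
                          { to = to ; from = from ; to∘from = to∘from ; from∘to = from∘to
                          ; to-U = λ u → W⇒U (to-U (U⇒W u)) ; from-U = λ u → W⇒U (from-U (U⇒W u))
                          ; preserves = λ u v → preserves (U⇒W u) (U⇒W v) })
                    in t , λ v w → eq v (W⇒U w) }
    where open Rigid R

  -- No vertex of U may look like the new one: of two distinct colours, at
  -- least one is such that no vertex of U has all its edges in that colour.
  module _ {U : Fin m → Set} (U? : Decidable U) (R : Rigid σ k U)
           {a b : Fin m} (Ua : U a) (Ub : U b) (a≢b : a ≢ b)
           {c₀ c₁ : Fin k} (c₀≢c₁ : c₀ ≢ c₁)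
           {f : Fin m} (sf : s f ≡ f) (f∉U : ¬ U f) where
    open Rigid R

    Homogeneous : Fin k → Fin m → Set
    Homogeneous c u = U u × (∀ w → U w → w ≢ u → edge w u ≡ c)

    homogeneous? : ∀ c → Decidable (Homogeneous c)
    homogeneous? c u = U? u ×-dec Fin.all? λ w → U? w →-dec (¬? (w Fin.≟ u) →-dec (edge w u Fin.≟ c))

    other : ∀ u → ∃ λ w → U w × w ≢ u
    other u with a Fin.≟ u
    ... | no  a≢u  = a , Ua , a≢u
    ... | yes refl = b , Ub , a≢b ∘ sym

    not-both : ∀ {u v} → Homogeneous c₀ u → Homogeneous c₁ v → ⊥
    not-both {u} {v} (Uu , hu) (Uv , hv) with u Fin.≟ v
    ... | no u≢v = c₀≢c₁ (trans (sym (hu v Uv (u≢v ∘ sym))) (trans (symmetric v u) (hv u Uu u≢v)))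
    ... | yes refl with (w , Uw , w≢u) ← other u = c₀≢c₁ (trans (sym (hu w Uw w≢u)) (hv w Uw w≢u))

    free-colour : ∃ λ c → ∀ u → ¬ Homogeneous c u
    free-colour with Fin.any? (homogeneous? c₀)
    ... | no  none    = c₀ , λ u h → none (u , h)
    ... | yes (u , h) = c₁ , λ v h′ → not-both h h′

    edge⁺ : Fin m → Fin m → Fin k
    edge⁺ u v with u Fin.≟ f | v Fin.≟ f
    ... | no _ | no _ = edge u v
    ... | _    | _    = proj₁ free-colour

    edge⁺-old : ∀ {u v} → u ≢ f → v ≢ f → edge⁺ u v ≡ edge u v
    edge⁺-old {u} {v} u≢ v≢ with u Fin.≟ f | v Fin.≟ f
    ... | no _  | no _  = refl
    ... | yes e | _     = contradiction e u≢
    ... | no _  | yes e = contradiction e v≢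

    edge⁺-newʳ : ∀ u {v} → v ≡ f → edge⁺ u v ≡ proj₁ free-colour
    edge⁺-newʳ u {v} e with u Fin.≟ f | v Fin.≟ f
    ... | no _  | no n  = contradiction e n
    ... | yes _ | _     = refl
    ... | no _  | yes _ = refl

    edge⁺-newˡ : ∀ {u} v → u ≡ f → edge⁺ u v ≡ proj₁ free-colour
    edge⁺-newˡ {u} v e with u Fin.≟ f | v Fin.≟ f
    ... | no n  | no _  = contradiction e n
    ... | yes _ | _     = refl
    ... | no _  | yes _ = refl

    s≡f : ∀ {u} → s u ≡ f → u ≡ f
    s≡f e = s-injective (trans e (sym sf))

    -- If an automorphism sent `f` into `U`, the image of `f` would be homogeneous in the free
    -- colour. So `f` stays fixed, and the rest is an automorphism of the old graph.
    add-fixed : Rigid σ k (λ v → v ≡ f ⊎ U v)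
    add-fixed = record { edge = edge⁺ ; symmetric = sym⁺ ; invariant = inv⁺ ; rigid = rigid⁺ }
      where
      sym⁺ : ∀ u v → edge⁺ u v ≡ edge⁺ v u
      sym⁺ u v with u Fin.≟ f | v Fin.≟ f
      ... | no  _ | no  _ = symmetric u v
      ... | yes _ | yes _ = refl
      ... | no  _ | yes _ = refl
      ... | yes _ | no  _ = refl

      inv⁺ : ∀ u v → edge⁺ (s u) (s v) ≡ edge⁺ u v
      inv⁺ u v with u Fin.≟ f | v Fin.≟ f
      ... | yes refl | _        = edge⁺-newˡ (s v) sf
      ... | no  _    | yes refl = edge⁺-newʳ (s u) sf
      ... | no  u≢   | no  v≢   = trans (edge⁺-old (u≢ ∘ s≡f) (v≢ ∘ s≡f)) (invariant u v)

      rigid⁺ : (φ : LocalAut edge⁺ (λ v → v ≡ f ⊎ U v)) →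
               ∃ λ t → ∀ v → v ≡ f ⊎ U v → LocalAut.to φ v ≡ pow σ t v
      rigid⁺ φ = proj₁ on-U , λ where
          _ (inj₁ refl) → trans to-f (sym (fixed-pow sf (proj₁ on-U)))
          v (inj₂ Uv)   → proj₂ on-U v Uv
        where
        open LocalAut φ
        to-f : to f ≡ f
        to-f with to-U (inj₁ refl)
        ... | inj₁ e = e
        ... | inj₂ Utf = contradiction (Utf , homog) (proj₂ free-colour (to f))
          where
          homog : ∀ w → U w → w ≢ to f → edge w (to f) ≡ proj₁ free-colour
          homog w Uw w≢ = begin
            edge w (to f)             ≡⟨ edge⁺-old (λ { refl → f∉U Uw }) (λ e → f∉U (subst U e Utf)) ⟨
            edge⁺ w (to f)            ≡⟨ cong (λ t → edge⁺ t (to f)) (to∘from w) ⟨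
            edge⁺ (to (from w)) (to f) ≡⟨ preserves (from-U (inj₂ Uw)) (inj₁ refl) (λ e → w≢ (trans (sym (to∘from w)) (cong to e))) ⟩
            edge⁺ (from w) f          ≡⟨ edge⁺-newʳ (from w) refl ⟩
            proj₁ free-colour           ∎ where open ≡-Reasoning
        old : ∀ {v} → U v → v ≢ f
        old Uv refl = f∉U Uv
        strip : ∀ {v} → v ≢ f → v ≡ f ⊎ U v → U v
        strip n (inj₁ e) = contradiction e n
        strip n (inj₂ u) = u
        to≢ : ∀ {v} → U v → to v ≢ f
        to≢ Uv e = old Uv (to-injective (trans e (sym to-f)))
        from≢ : ∀ {v} → U v → from v ≢ f
        from≢ {v} Uv e = old Uv (trans (sym (to∘from v)) (trans (cong to e) to-f))
        on-U = rigid record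
          { to = to ; from = from ; to∘from = to∘from ; from∘to = from∘to
          ; to-U = λ Uv → strip (to≢ Uv) (to-U (inj₂ Uv))
          ; from-U = λ Uv → strip (from≢ Uv) (from-U (inj₂ Uv))
          ; preserves = λ Uu Uv u≢v → trans (sym (edge⁺-old (to≢ Uu) (to≢ Uv)))
                          (trans (preserves (inj₂ Uu) (inj₂ Uv) u≢v) (edge⁺-old (old Uu) (old Uv))) }

  Moved : Fin m → Set
  Moved v = s v ≢ v

  moved? : Decidable Moved
  moved? v = ¬? (s v Fin.≟ v)

  ∈⊎moved? : ∀ fs → Decidable (λ v → v ∈ fs ⊎ Moved v)
  ∈⊎moved? fs v = _∈?_ Fin._≟_ v fs ⊎-dec moved? v

  -- Moved vertices and repetitions in `fs` are skipped, so `fs` can be the list of all vertices.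
  -- The vertices `x` and `s x` are the two distinct ones on which the choice of a free colour
  -- relies.
  add-all-fixed : {x : Fin m} → Moved x → {c₀ c₁ : Fin k} → c₀ ≢ c₁ →
                  Rigid σ k Moved → ∀ fs → Rigid σ k (λ v → v ∈ fs ⊎ Moved v)
  add-all-fixed mx c≢ R [] = resp-⇔ inj₂ (λ { (inj₂ u) → u }) R
  add-all-fixed {x} mx c≢ R (f ∷ fs) with R′ ← add-all-fixed mx c≢ R fs | ∈⊎moved? fs f
  ... | yes old = resp-⇔ (λ { (inj₁ v) → inj₁ (there v) ; (inj₂ u) → inj₂ u })
                         (λ { (inj₁ (here refl)) → old ; (inj₁ (there v)) → inj₁ v ; (inj₂ u) → inj₂ u }) R′
  ... | no new = resp-⇔ (λ { (inj₁ refl) → inj₁ (here refl) ; (inj₂ (inj₁ v)) → inj₁ (there v) ; (inj₂ (inj₂ u)) → inj₂ u })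
                        (λ { (inj₁ (here refl)) → inj₁ refl ; (inj₁ (there v)) → inj₂ (inj₁ v) ; (inj₂ u) → inj₂ (inj₂ u) })
                        (add-fixed (∈⊎moved? fs) R′ (inj₂ mx) (inj₂ (mx ∘ s-injective)) (mx ∘ sym) c≢
                          (decidable-stable (s f Fin.≟ f) (new ∘ inj₂)) new)

  Moved⇒GR : {x : Fin m} → Moved x → {c₀ c₁ : Fin k} → c₀ ≢ c₁ → Rigid σ k Moved → GR k ⟨ σ ⟩
  Moved⇒GR mx c≢ R₀ = record { E = edge ; symm = symmetric } , λ π →
      (λ (j , eq) x y _ → trans (cong₂ edge (eq x) (eq y)) (pow-invariant invariant j x y)) ,
      (λ aut → let (t , eq) = rigid record
                     { to = π ⟨$⟩ʳ_ ; from = π ⟨$⟩ˡ_ ; to∘from = λ _ → inverseʳ π ; from∘to = λ _ → inverseˡ π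
                     ; to-U = λ _ → inj₁ (∈-allFin _) ; from-U = λ _ → inj₁ (∈-allFin _)
                     ; preserves = λ _ _ → aut _ _ }
               in t , λ x → eq x (inj₁ (∈-allFin x)))
    where open Rigid (add-all-fixed mx c≢ R₀ (allFin m))

-- Graphs on layered orbits

-- The orbits of σ are its layers, numbered from 0; p sends each layer
-- equivariantly onto the next one.
record Layers {m : ℕ} (σ : Permutation′ m) : Set where
  open Powers σ
  field
    lev        : Fin m → ℕ
    p          : Fin m → Fin m
    lev-s      : ∀ v → lev (s v) ≡ lev v
    p-s        : ∀ v → p (s v) ≡ s (p v)
    transitive : ∀ {u v} → lev u ≡ lev v → ∃ λ j → v ≡ pow σ j u
    preimage   : ∀ {v k} → lev v ≡ suc k → ∃ λ u → lev u ≡ k × p u ≡ v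

PeriodMultipleOf : {m : ℕ} → Permutation′ m → ℕ → Fin m → Set
PeriodMultipleOf σ d v = ∀ k → pow σ k v ≡ v → d ∣ k

bit : ∀ {A : Set} → Dec A → Fin 2
bit (yes _) = suc zero
bit (no _)  = zero

bit-true : ∀ {A : Set} (a? : Dec A) → A → bit a? ≡ suc zero
bit-true (yes _) _ = refl
bit-true (no n)  a = contradiction a n

bit-yes : ∀ {A : Set} (a? : Dec A) → bit a? ≡ suc zero → A
bit-yes (yes a) _ = a

bit-cong : ∀ {A B : Set} (a? : Dec A) (b? : Dec B) → (A → B) → (B → A) → bit a? ≡ bit b?
bit-cong (yes a) b? f g = sym (bit-true b? (f a))
bit-cong (no n) (yes b) f g = contradiction (g b) n
bit-cong (no _) (no _)  f g = refl

inverse : ∀ {m} {C : Set} {E : Fin m → Fin m → C} {U} → LocalAut E U → LocalAut E U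
inverse {E = E} φ = record
  { to = from ; from = to ; to∘from = from∘to ; from∘to = to∘from ; to-U = from-U ; from-U = to-U
  ; preserves = λ {u} {v} Uu Uv u≢v → trans
      (sym (preserves (from-U Uu) (from-U Uv) (λ e → u≢v (trans (sym (to∘from u)) (trans (cong to e) (to∘from v))))))
      (cong₂ E (to∘from u) (to∘from v)) }
  where open LocalAut φ

module Layered {m : ℕ} {σ : Permutation′ m} (L : Layers σ)
               {M : ℕ} (σ^N : IsIdPower σ (suc M)) where
  open Layers L public
  open Powers σ public
  open Extension σ 0 public using (Moved; moved?)

  clash : ∀ {A : Set} {a b} v → lev v ≡ a → lev v ≡ b → a ≢ b → A
  clash v e f n = contradiction (trans (sym e) f) n

  Moved-pow : ∀ t {v} → Moved v → Moved (pow σ t v)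
  Moved-pow t {v} mv e = mv (pow-injective t (trans (sym (pow-comm 1 t v)) e))

  Moved-s⁻ : ∀ {v} → Moved (s v) → Moved v
  Moved-s⁻ mv e = mv (cong s e)

  layer-fixed : ∀ {f : Fin m → Fin m} {x} → lev x ≡ 0 → f x ≡ x →
                (∀ {x} → lev x ≡ 0 → f x ≡ x → f (s x) ≡ s x) → ∀ {v} → lev v ≡ 0 → f v ≡ v
  layer-fixed {f} {x} x₀ fx step v₀ with j , refl ← transitive (trans x₀ (sym v₀)) = proj₂ (go j)
    where
    go : ∀ j → lev (pow σ j x) ≡ 0 × f (pow σ j x) ≡ pow σ j x
    go zero    = x₀ , fx
    go (suc j) with (l , e) ← go j = trans (lev-s _) l , step l e

  lev-pow : ∀ j v → lev (pow σ j v) ≡ lev v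
  lev-pow zero    v = refl
  lev-pow (suc j) v = trans (lev-s _) (lev-pow j v)

  lev-p : ∀ {x k} → lev (p x) ≡ suc k → ∀ {u} → lev x ≡ lev u → lev (p u) ≡ suc k
  lev-p {x} {k} px u~x with j , refl ← transitive u~x = go j
    where
    go : ∀ j → lev (p (pow σ j x)) ≡ suc k
    go zero    = px
    go (suc j) = trans (cong lev (p-s _)) (trans (lev-s _) (go j))

  -- `preimage` gives one vertex of layer `k` that `p` sends to layer `suc k`, and `σ` carries this
  -- to the whole layer. The vertex `y` witnesses that layer `suc k` exists; on the last layer `p`
  -- does not raise the level.
  p-layer : ∀ {y k} → lev y ≡ suc k → ∀ {u} → lev u ≡ k → lev (p u) ≡ suc k
  p-layer yk uk with x , xk , refl ← preimage yk = lev-p yk (trans xk (sym uk))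

  module _ {k : ℕ} (E : Fin m → Fin m → Fin k)
           (symmetric : ∀ u v → E u v ≡ E v u) (invariant : ∀ u v → E (s u) (s v) ≡ E u v)
           {x₀ : Fin m} (lev-x₀ : lev x₀ ≡ 0)
           (keeps-layer-0 : (φ : LocalAut E Moved) → ∀ {x} → lev x ≡ 0 → lev (LocalAut.to φ x) ≡ 0)
           (fixes-all : (φ : LocalAut E Moved) → ∀ {x} → lev x ≡ 0 → LocalAut.to φ x ≡ x →
                        ∀ v → Moved v → LocalAut.to φ v ≡ v) where

    -- An automorphism takes `x₀` to some `σᵗ x₀`; followed by `σ⁻ᵗ` it fixes `x₀`, hence every
    -- moved vertex, so it was `σᵗ` there. The inverse of `σᵗ` is written as the power `M * t`.
    stabiliser⇒rigid : Rigid σ k Moved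
    stabiliser⇒rigid = record { edge = E ; symmetric = symmetric ; invariant = invariant ; rigid = rig }
      where
      rig : (φ : LocalAut E Moved) → ∃ λ t → ∀ v → Moved v → LocalAut.to φ v ≡ pow σ t v
      rig φ with t , eq ← transitive (trans lev-x₀ (sym (keeps-layer-0 φ lev-x₀))) = t , λ v mv →
          trans (sym (forth (to v))) (cong (pow σ t) (fixes-all ψ lev-x₀ (trans (cong (pow σ (M * t)) eq) (back x₀)) v mv))
        where
        open LocalAut φ
        id-power : ∀ v → pow σ (suc M * t) v ≡ v
        id-power v = trans (cong (λ i → pow σ i v) (*-comm (suc M) t)) (pow-*-fix t (σ^N v))
        forth : ∀ v → pow σ t (pow σ (M * t) v) ≡ v
        forth v = trans (sym (pow-+ t (M * t) v)) (id-power v)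
        back : ∀ v → pow σ (M * t) (pow σ t v) ≡ v
        back v = trans (pow-comm (M * t) t v) (forth v)
        ψ : LocalAut E Moved
        ψ = record
          { to = λ v → pow σ (M * t) (to v) ; from = λ v → from (pow σ t v)
          ; to∘from = λ v → trans (cong (pow σ (M * t)) (to∘from _)) (back v)
          ; from∘to = λ v → trans (cong from (forth _)) (from∘to v)
          ; to-U = λ mv → Moved-pow (M * t) (to-U mv) ; from-U = λ mv → from-U (Moved-pow t mv)
          ; preserves = λ mu mv u≢v → trans (pow-invariant invariant (M * t) _ _) (preserves mu mv u≢v) }

  -- A graph with all edges inside Moved, coded by the colours 1 (edge) and 0.
  module Graph (_⇒_ : Fin m → Fin m → Set) (_⇒?_ : ∀ u v → Dec (u ⇒ v))
               (⇒-s : ∀ {u v} → u ⇒ v → s u ⇒ s v) (⇒-s⁻ : ∀ {u v} → s u ⇒ s v → u ⇒ v)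
               (⇒-irreflexive : ∀ {u} → ¬ u ⇒ u)
               (⇒-moved : ∀ {u v} → u ⇒ v → Moved u × Moved v) where

    infix 4 _~_
    _~_ : Fin m → Fin m → Set
    u ~ v = u ⇒ v ⊎ v ⇒ u

    _~?_ : ∀ u v → Dec (u ~ v)
    u ~? v = (u ⇒? v) ⊎-dec (v ⇒? u)

    edge : Fin m → Fin m → Fin 2
    edge u v = bit (u ~? v)

    edge-~ : ∀ {a b c d} → edge a b ≡ edge c d → c ~ d → a ~ b
    edge-~ e h = bit-yes (_ ~? _) (trans e (bit-true (_ ~? _) h))

    edge-symmetric : ∀ u v → edge u v ≡ edge v u
    edge-symmetric u v = bit-cong (u ~? v) (v ~? u) swap swap

    edge-invariant : ∀ u v → edge (s u) (s v) ≡ edge u v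
    edge-invariant u v = bit-cong (s u ~? s v) (u ~? v) (Sum.map ⇒-s⁻ ⇒-s⁻) (Sum.map ⇒-s ⇒-s)

    irreflexive : ∀ {u} → ¬ u ~ u
    irreflexive (inj₁ h) = ⇒-irreflexive h
    irreflexive (inj₂ h) = ⇒-irreflexive h

    ~-movedˡ : ∀ {u v} → u ~ v → Moved u
    ~-movedˡ (inj₁ h) = proj₁ (⇒-moved h)
    ~-movedˡ (inj₂ h) = proj₂ (⇒-moved h)

    ~-movedʳ : ∀ {u v} → u ~ v → Moved v
    ~-movedʳ = ~-movedˡ ∘ swap

    module Automorphism (φ : LocalAut edge Moved) where
      open LocalAut φ public

      to-~ : ∀ {u v} → u ~ v → to u ~ to v
      to-~ {u} {v} h = edge-~ (preserves (~-movedˡ h) (~-movedʳ h) λ { refl → irreflexive {u} h }) h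

    to-~-from : (φ : LocalAut edge Moved) → ∀ {u v} → LocalAut.to φ u ~ v → u ~ LocalAut.from φ v
    to-~-from φ {u} {v} h = subst (_~ from v) (from∘to u) (Automorphism.to-~ (inverse φ) h)
      where open LocalAut φ

-- At least three nontrivial orbits: two colours

module ThreeOrbits {m : ℕ} {σ : Permutation′ m} (L : Layers σ) {M : ℕ} (σ^N : IsIdPower σ (suc M)) where
  open Layered L {M} σ^N

  module _ (period-4 : ∀ {v} → lev v ≡ 1 → PeriodMultipleOf σ 4 v)
           (period-2 : ∀ {v} → Moved v → PeriodMultipleOf σ 2 v)
           {z₀ : Fin m} (z₀-layer : lev z₀ ≡ 2) (z₀-moved : Moved z₀) where

    pattern down l e mv = inj₁ (l , e , mv)
    pattern cycle₀ l e  = inj₂ (inj₁ (l , e))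
    pattern skew l e    = inj₂ (inj₂ (inj₁ (l , e)))
    pattern skip l e    = inj₂ (inj₂ (inj₂ (inj₁ (l , e))))
    pattern cycle₂ l e  = inj₂ (inj₂ (inj₂ (inj₂ (l , e))))

    infix 4 _⇒_ _⇒?_
    -- `Moved v` keeps the layers of fixed points out of the graph. The edge from `u` to `σ⁻¹ (p u)`
    -- is expressed by `s v ≡ p u`, which avoids inverses.
    _⇒_ : Fin m → Fin m → Set
    u ⇒ v = (lev v ≡ suc (lev u) × v ≡ p u × Moved v)
          ⊎ (lev u ≡ 0 × v ≡ s u)
          ⊎ (lev u ≡ 0 × s v ≡ p u)
          ⊎ (lev u ≡ 0 × v ≡ p (p u))
          ⊎ (lev u ≡ 2 × v ≡ s u)

    _⇒?_ : ∀ u v → Dec (u ⇒ v)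
    u ⇒? v = ((lev v ℕ.≟ suc (lev u)) ×-dec (v Fin.≟ p u) ×-dec moved? v)
       ⊎-dec ((lev u ℕ.≟ 0) ×-dec (v Fin.≟ s u))
       ⊎-dec ((lev u ℕ.≟ 0) ×-dec (s v Fin.≟ p u))
       ⊎-dec ((lev u ℕ.≟ 0) ×-dec (v Fin.≟ p (p u)))
       ⊎-dec ((lev u ℕ.≟ 2) ×-dec (v Fin.≟ s u))

    y₀ : ∃ λ y → lev y ≡ 1 × p y ≡ z₀
    y₀ = preimage z₀-layer

    p-0 : ∀ {x} → lev x ≡ 0 → lev (p x) ≡ 1
    p-0 = p-layer (proj₁ (proj₂ y₀))

    p-1 : ∀ {y} → lev y ≡ 1 → lev (p y) ≡ 2
    p-1 = p-layer z₀-layer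

    pp-s : ∀ v → p (p (s v)) ≡ s (p (p v))
    pp-s v = trans (cong p (p-s v)) (p-s (p v))

    skew-0 : ∀ {u v} → lev u ≡ 0 → s v ≡ p u → lev v ≡ 1
    skew-0 {u} {v} l e = trans (sym (lev-s v)) (trans (cong lev e) (p-0 l))

    skip-0 : ∀ {u v} → lev u ≡ 0 → v ≡ p (p u) → lev v ≡ 2
    skip-0 l refl = p-1 (p-0 l)

    moved-2 : ∀ {z} → lev z ≡ 2 → Moved z
    moved-2 z₂ with j , refl ← transitive (trans z₀-layer (sym z₂)) = Moved-pow j z₀-moved

    moved-1 : ∀ {y} → lev y ≡ 1 → Moved y
    moved-1 {y} y₁ e = moved-2 (p-1 y₁) (trans (sym (p-s y)) (cong p e))

    moved-0 : ∀ {x} → lev x ≡ 0 → Moved x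
    moved-0 {x} x₀ e = moved-1 (p-0 x₀) (trans (sym (p-s x)) (cong p e))

    s²-1 : ∀ {y} → lev y ≡ 1 → s (s y) ≢ y
    s²-1 y₁ e = from-no (4 ∣? 2) (period-4 y₁ 2 e)

    s³-0 : ∀ {x} → lev x ≡ 0 → s (s (s x)) ≢ x
    s³-0 {x} x₀ e = from-no (4 ∣? 3) (period-4 (p-0 x₀) 3
      (trans (sym (trans (p-s _) (cong s (trans (p-s _) (cong s (p-s x)))))) (cong p e)))

    -- Layer 2 may have size 2, so only parity is available. It excludes a 3-cycle, the one way in
    -- which `z — s z` could be in a triangle inside layer 2.
    s³-2 : ∀ {z} → lev z ≡ 2 → s (s (s z)) ≢ z
    s³-2 z₂ e = from-no (2 ∣? 3) (period-2 (moved-2 z₂) 3 e)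

    ⇒-s : ∀ {u v} → u ⇒ v → s u ⇒ s v
    ⇒-s {u} {v} (down l refl mv) = down (trans (lev-s v) (trans l (cong suc (sym (lev-s u))))) (sym (p-s u)) (mv ∘ s-injective)
    ⇒-s {u} (cycle₀ l refl) = cycle₀ (trans (lev-s u) l) refl
    ⇒-s {u} (skew l e)      = skew (trans (lev-s u) l) (trans (cong s e) (sym (p-s u)))
    ⇒-s {u} (skip l refl)   = skip (trans (lev-s u) l) (sym (pp-s u))
    ⇒-s {u} (cycle₂ l refl) = cycle₂ (trans (lev-s u) l) refl

    ⇒-s⁻ : ∀ {u v} → s u ⇒ s v → u ⇒ v
    ⇒-s⁻ {u} {v} (down l e mv) = down (trans (sym (lev-s v)) (trans l (cong suc (lev-s u)))) (s-injective (trans e (p-s u))) (Moved-s⁻ mv)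
    ⇒-s⁻ {u} (cycle₀ l e) = cycle₀ (trans (sym (lev-s u)) l) (s-injective e)
    ⇒-s⁻ {u} (skew l e)   = skew (trans (sym (lev-s u)) l) (s-injective (trans e (p-s u)))
    ⇒-s⁻ {u} (skip l e)   = skip (trans (sym (lev-s u)) l) (s-injective (trans e (pp-s u)))
    ⇒-s⁻ {u} (cycle₂ l e) = cycle₂ (trans (sym (lev-s u)) l) (s-injective e)

    ⇒-irreflexive : ∀ {u} → ¬ u ⇒ u
    ⇒-irreflexive (down l e mv) = 1+n≢n (sym l)
    ⇒-irreflexive (cycle₀ l e)  = moved-0 l (sym e)
    ⇒-irreflexive {u} (skew l e) = clash u l (skew-0 l e) λ ()
    ⇒-irreflexive {u} (skip l e) = clash u l (skip-0 l e) λ ()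
    ⇒-irreflexive (cycle₂ l e)  = moved-2 l (sym e)

    ⇒-moved : ∀ {u v} → u ⇒ v → Moved u × Moved v
    ⇒-moved {u} (down l refl mv) = (λ e → mv (trans (sym (p-s u)) (cong p e))) , mv
    ⇒-moved (cycle₀ l refl) = moved-0 l , moved-0 l ∘ s-injective
    ⇒-moved (skew l e)      = moved-0 l , moved-1 (skew-0 l e)
    ⇒-moved (skip l e)      = moved-0 l , moved-2 (skip-0 l e)
    ⇒-moved (cycle₂ l refl) = moved-2 l , moved-2 l ∘ s-injective

    open Graph _⇒_ _⇒?_ ⇒-s ⇒-s⁻ ⇒-irreflexive ⇒-moved

    data Nbr₀ (x u : Fin m) : Set where
      next  : lev u ≡ 0 → u ≡ s x → Nbr₀ x u
      prev  : lev u ≡ 0 → x ≡ s u → Nbr₀ x u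
      mid   : lev u ≡ 1 → u ≡ p x → Nbr₀ x u
      mid⁻  : lev u ≡ 1 → s u ≡ p x → Nbr₀ x u
      tip   : lev u ≡ 2 → u ≡ p (p x) → Nbr₀ x u

    nbr₀ : ∀ {x u} → lev x ≡ 0 → x ~ u → Nbr₀ x u
    nbr₀ l (inj₁ (down l′ e mv)) = mid (trans l′ (cong suc l)) e
    nbr₀ {x} l (inj₁ (cycle₀ _ refl)) = next (trans (lev-s x) l) refl
    nbr₀ l (inj₁ (skew _ e)) = mid⁻ (skew-0 l e) e
    nbr₀ l (inj₁ (skip _ e)) = tip (skip-0 l e) e
    nbr₀ {x} l (inj₁ (cycle₂ l′ e)) = clash x l l′ λ ()
    nbr₀ {x} l (inj₂ (down l′ e mv)) = clash x l l′ λ ()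
    nbr₀ l (inj₂ (cycle₀ l′ e)) = prev l′ e
    nbr₀ {x} l (inj₂ (skew l′ e)) = clash x l (skew-0 l′ e) λ ()
    nbr₀ {x} l (inj₂ (skip l′ e)) = clash x l (skip-0 l′ e) λ ()
    nbr₀ {x} l (inj₂ (cycle₂ l′ refl)) = clash x l (trans (lev-s _) l′) λ ()

    data Nbr₁ (y u : Fin m) : Set where
      over  : lev u ≡ 0 → y ≡ p u → Nbr₁ y u
      over⁺ : lev u ≡ 0 → s y ≡ p u → Nbr₁ y u
      below : lev u ≡ 2 → u ≡ p y → Nbr₁ y u

    nbr₁ : ∀ {y u} → lev y ≡ 1 → y ~ u → Nbr₁ y u
    nbr₁ l (inj₁ (down l′ e mv)) = below (trans l′ (cong suc l)) e
    nbr₁ {y} l (inj₁ (cycle₀ l′ _)) = clash y l l′ λ ()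
    nbr₁ {y} l (inj₁ (skew l′ e)) = clash y l l′ λ ()
    nbr₁ {y} l (inj₁ (skip l′ e)) = clash y l l′ λ ()
    nbr₁ {y} l (inj₁ (cycle₂ l′ e)) = clash y l l′ λ ()
    nbr₁ l (inj₂ (down l′ e mv)) = over (suc-injective (trans (sym l′) l)) e
    nbr₁ {y} l (inj₂ (cycle₀ l′ refl)) = clash y l (trans (lev-s _) l′) λ ()
    nbr₁ l (inj₂ (skew l′ e)) = over⁺ l′ e
    nbr₁ {y} l (inj₂ (skip l′ e)) = clash y l (skip-0 l′ e) λ ()
    nbr₁ {y} l (inj₂ (cycle₂ l′ refl)) = clash y l (trans (lev-s _) l′) λ ()

    data Nbr₂ (z u : Fin m) : Set where
      apex  : lev u ≡ 0 → z ≡ p (p u) → Nbr₂ z u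
      over  : lev u ≡ 1 → z ≡ p u → Nbr₂ z u
      next  : lev u ≡ 2 → u ≡ s z → Nbr₂ z u
      prev  : lev u ≡ 2 → z ≡ s u → Nbr₂ z u
      below : lev u ≡ 3 → u ≡ p z → Nbr₂ z u

    nbr₂ : ∀ {z u} → lev z ≡ 2 → z ~ u → Nbr₂ z u
    nbr₂ l (inj₁ (down l′ e mv)) = below (trans l′ (cong suc l)) e
    nbr₂ {y} l (inj₁ (cycle₀ l′ _)) = clash y l l′ λ ()
    nbr₂ {y} l (inj₁ (skew l′ e)) = clash y l l′ λ ()
    nbr₂ {y} l (inj₁ (skip l′ e)) = clash y l l′ λ ()
    nbr₂ l (inj₁ (cycle₂ l′ refl)) = next (trans (lev-s _) l) refl
    nbr₂ l (inj₂ (down l′ e mv)) = over (suc-injective (trans (sym l′) l)) e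
    nbr₂ {y} l (inj₂ (cycle₀ l′ refl)) = clash y l (trans (lev-s _) l′) λ ()
    nbr₂ {y} l (inj₂ (skew l′ e)) = clash y l (skew-0 l′ e) λ ()
    nbr₂ l (inj₂ (skip l′ e)) = apex l′ e
    nbr₂ l (inj₂ (cycle₂ l′ e)) = prev l′ e

    data Nbr₃ (k : ℕ) (w u : Fin m) : Set where
      over  : lev u ≡ 2 + k → w ≡ p u → Nbr₃ k w u
      below : lev u ≡ 4 + k → u ≡ p w → Nbr₃ k w u

    nbr₃ : ∀ {k w u} → lev w ≡ 3 + k → w ~ u → Nbr₃ k w u
    nbr₃ l (inj₁ (down l′ e mv)) = below (trans l′ (cong suc l)) e
    nbr₃ {w = y} l (inj₁ (cycle₀ l′ _)) = clash y l l′ λ ()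
    nbr₃ {w = y} l (inj₁ (skew l′ e)) = clash y l l′ λ ()
    nbr₃ {w = y} l (inj₁ (skip l′ e)) = clash y l l′ λ ()
    nbr₃ {w = y} l (inj₁ (cycle₂ l′ refl)) = clash y l l′ λ ()
    nbr₃ l (inj₂ (down l′ e mv)) = over (suc-injective (trans (sym l′) l)) e
    nbr₃ {w = y} l (inj₂ (cycle₀ l′ refl)) = clash y l (trans (lev-s _) l′) λ ()
    nbr₃ {w = y} l (inj₂ (skew l′ e)) = clash y l (skew-0 l′ e) λ ()
    nbr₃ {w = y} l (inj₂ (skip l′ e)) = clash y l (skip-0 l′ e) λ ()
    nbr₃ {w = y} l (inj₂ (cycle₂ l′ refl)) = clash y l (trans (lev-s _) l′) λ ()

    adj₀₀ : ∀ {x u} → lev x ≡ 0 → lev u ≡ 0 → x ~ u → u ≡ s x ⊎ x ≡ s u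
    adj₀₀ {u = u} l l′ h with nbr₀ l h
    ... | next _ e = inj₁ e
    ... | prev _ e = inj₂ e
    ... | mid  k _ = clash u k l′ λ ()
    ... | mid⁻ k _ = clash u k l′ λ ()
    ... | tip  k _ = clash u k l′ λ ()

    adj₀₁ : ∀ {x u} → lev x ≡ 0 → lev u ≡ 1 → x ~ u → u ≡ p x ⊎ s u ≡ p x
    adj₀₁ {u = u} l l′ h with nbr₀ l h
    ... | mid  _ e = inj₁ e
    ... | mid⁻ _ e = inj₂ e
    ... | next k _ = clash u k l′ λ ()
    ... | prev k _ = clash u k l′ λ ()
    ... | tip  k _ = clash u k l′ λ ()

    adj₀₂ : ∀ {x u} → lev x ≡ 0 → lev u ≡ 2 → x ~ u → u ≡ p (p x)
    adj₀₂ {u = u} l l′ h with nbr₀ l h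
    ... | tip  _ e = e
    ... | next k _ = clash u k l′ λ ()
    ... | prev k _ = clash u k l′ λ ()
    ... | mid  k _ = clash u k l′ λ ()
    ... | mid⁻ k _ = clash u k l′ λ ()

    ¬adj₁₁ : ∀ {y u} → lev y ≡ 1 → lev u ≡ 1 → ¬ y ~ u
    ¬adj₁₁ {u = u} l l′ h with nbr₁ l h
    ... | over  k _ = clash u k l′ λ ()
    ... | over⁺ k _ = clash u k l′ λ ()
    ... | below k _ = clash u k l′ λ ()

    adj₁₂ : ∀ {y u} → lev y ≡ 1 → lev u ≡ 2 → y ~ u → u ≡ p y
    adj₁₂ {u = u} l l′ h with nbr₁ l h
    ... | below _ e = e
    ... | over  k _ = clash u k l′ λ ()
    ... | over⁺ k _ = clash u k l′ λ ()

    adj₂₂ : ∀ {z u} → lev z ≡ 2 → lev u ≡ 2 → z ~ u → u ≡ s z ⊎ z ≡ s u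
    adj₂₂ {u = u} l l′ h with nbr₂ l h
    ... | next  _ e = inj₁ e
    ... | prev  _ e = inj₂ e
    ... | apex  k _ = clash u k l′ λ ()
    ... | over  k _ = clash u k l′ λ ()
    ... | below k _ = clash u k l′ λ ()

    adj₂₃ : ∀ {z u} → lev z ≡ 2 → lev u ≡ 3 → z ~ u → u ≡ p z
    adj₂₃ {u = u} l l′ h with nbr₂ l h
    ... | below _ e = e
    ... | apex  k _ = clash u k l′ λ ()
    ... | over  k _ = clash u k l′ λ ()
    ... | next  k _ = clash u k l′ λ ()
    ... | prev  k _ = clash u k l′ λ ()

    ~next : ∀ {x} → lev x ≡ 0 → x ~ s x
    ~next l = inj₁ (cycle₀ l refl)

    ~p : ∀ {x} → lev x ≡ 0 → x ~ p x
    ~p l = inj₁ (down (trans (p-0 l) (cong suc (sym l))) refl (moved-1 (p-0 l)))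

    ~p⁻ : ∀ {x u} → lev x ≡ 0 → s u ≡ p x → x ~ u
    ~p⁻ l e = inj₁ (skew l e)

    ~pp : ∀ {x} → lev x ≡ 0 → x ~ p (p x)
    ~pp l = inj₁ (skip l refl)

    ~p₁ : ∀ {y} → lev y ≡ 1 → y ~ p y
    ~p₁ l = inj₁ (down (trans (p-1 l) (cong suc (sym l))) refl (moved-2 (p-1 l)))

    -- Layer 0 consists of the moved vertices with both of the following properties: layer 1 fails
    -- the second, all further layers the first.
    EdgesInTriangles : Fin m → Set
    EdgesInTriangles v = ∀ u → v ~ u → ∃ λ w → v ~ w × u ~ w

    -- Only the two sides at `v` must lie in no other triangle. In `thin₀` the third side, from `a`
    -- to `p a`, also lies in the triangle with `p (p a)`.
    ThinTriangle : Fin m → Set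
    ThinTriangle v = ∃ λ a → ∃ λ b → v ~ a × v ~ b × a ~ b ×
                     (∀ u → v ~ u → a ~ u → u ≡ b) × (∀ u → v ~ u → b ~ u → u ≡ a)

    -- Every edge at layer 0 is a side of a triangle `x, s x, p x` or `x, p x, p (p x)`.
    triangles₀ : ∀ {x} → lev x ≡ 0 → EdgesInTriangles x
    triangles₀ {x} l u h with nbr₀ l h
    ... | next l′ refl = p x , ~p l , ~p⁻ l′ (sym (p-s x))
    ... | prev l′ refl = p u , ~p⁻ l (sym (p-s u)) , ~p l′
    ... | mid l′ refl = s x , ~next l , swap (~p⁻ (trans (lev-s x) l) (sym (p-s x)))
    ... | tip l′ refl = p x , ~p l , swap (~p₁ (p-0 l))
    ... | mid⁻ l′ e with a , refl ← s-surjective x =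
          a , inj₂ (cycle₀ a₀ refl) , subst (_~ a) (sym (s-injective (trans e (p-s a)))) (swap (~p a₀))
        where a₀ = trans (sym (lev-s a)) l

    thin₀ : ∀ {a} → lev a ≡ 0 → ThinTriangle (s a)
    thin₀ {a} l = a , p a , swap (~next l) , ~p⁻ l⁺ (sym (p-s a)) , ~p l , only-b , only-a
      where
      l⁺ = trans (lev-s a) l
      p₁ = p-0 l
      only-b : ∀ u → s a ~ u → a ~ u → u ≡ p a
      only-b u h h′ with nbr₀ l⁺ h
      ... | mid⁻ _ e = s-injective (trans e (p-s a))
      ... | prev _ e with refl ← s-injective e = contradiction h′ irreflexive
      only-b u h h′ | next k refl with adj₀₀ l k h′
      ... | inj₁ e = contradiction (s-injective e) (moved-0 l)
      ... | inj₂ e = contradiction (sym e) (s³-0 l)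
      only-b u h h′ | mid k e with adj₀₁ l k h′
      ... | inj₁ e′ = e′
      ... | inj₂ e′ = contradiction (trans (cong s (trans (sym (p-s a)) (sym e))) e′) (s²-1 p₁)
      only-b u h h′ | tip k e =
        contradiction (trans (sym (pp-s a)) (trans (sym e) (adj₀₂ l k h′))) (moved-2 (p-1 p₁))
      only-a : ∀ u → s a ~ u → p a ~ u → u ≡ a
      only-a u h h′ with nbr₀ l⁺ h
      ... | prev _ e = sym (s-injective e)
      ... | mid  k e = contradiction h′ (¬adj₁₁ p₁ k)
      ... | mid⁻ k e = contradiction h′ (¬adj₁₁ p₁ k)
      ... | tip  k e =
        contradiction (trans (sym (pp-s a)) (trans (sym e) (adj₁₂ p₁ k h′))) (moved-2 (p-1 p₁))
      only-a u h h′ | next k refl with adj₀₁ k p₁ (swap h′)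
      ... | inj₁ e = contradiction (sym (trans e (trans (p-s _) (cong s (p-s a))))) (s²-1 p₁)
      ... | inj₂ e = contradiction (sym (s-injective (trans e (trans (p-s _) (cong s (p-s a)))))) (moved-1 p₁)

    -- Both `p (p a)` and `s a` are common neighbours of `p a` and `a`, and they lie in different
    -- layers.
    shared-edge : ∀ {y a b} → lev y ≡ 1 → lev a ≡ 0 → y ≡ p a → ¬ (∀ u → y ~ u → a ~ u → u ≡ b)
    shared-edge {a = a} l a₀ refl only = clash (p (p a)) (p-1 l)
      (trans (cong lev (trans (only _ (~p₁ l) (~pp a₀))
                              (sym (only _ (swap (~p⁻ (trans (lev-s a) a₀) (sym (p-s a)))) (~next a₀)))))
             (trans (lev-s a) a₀))
      λ ()

    ¬adj-over⁺-p : ∀ {y a} → lev y ≡ 1 → lev a ≡ 0 → s y ≡ p a → ¬ a ~ p y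
    ¬adj-over⁺-p {y} l a₀ e h = moved-2 (p-1 l)
      (trans (sym (p-s y)) (trans (cong p e) (sym (adj₀₂ a₀ (p-1 l) h))))

    -- By `shared-edge`, neither of the other two corners is mapped to `y` by `p`. The remaining
    -- neighbours of `y` are `p y` and the vertices over `s y`, and no two of these are adjacent.
    ¬thin₁ : ∀ {y} → lev y ≡ 1 → ¬ ThinTriangle y
    ¬thin₁ l (a , b , h , h′ , h″ , only-b , only-a) with nbr₁ l h | nbr₁ l h′
    ... | over a₀ e     | _             = shared-edge l a₀ e only-b
    ... | over⁺ _ _     | over b₀ e′    = shared-edge l b₀ e′ only-a
    ... | below _ _     | over b₀ e′    = shared-edge l b₀ e′ only-a
    ... | over⁺ a₀ e    | below _ refl  = ¬adj-over⁺-p l a₀ e h″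
    ... | below _ refl  | over⁺ b₀ e′   = ¬adj-over⁺-p l b₀ e′ (swap h″)
    ... | below _ refl  | below _ refl  = irreflexive h″
    ... | over⁺ a₀ e    | over⁺ b₀ e′ with adj₀₀ a₀ b₀ h″
    ...   | inj₁ refl = moved-1 (p-0 a₀) (trans (sym (p-s a)) (trans (sym e′) e))
    ...   | inj₂ refl = moved-1 (p-0 b₀) (trans (sym (p-s b)) (trans (sym e) e′))

    -- The edge `z — s z` lies in no triangle: a third vertex in layer 0 or 1 would have two
    -- neighbours in layer 2, and one in layer 3 would be `p z` and fixed by `σ`.
    ¬triangles₂ : ∀ {z} → lev z ≡ 2 → ¬ EdgesInTriangles z
    ¬triangles₂ {z} l t with w , h , h′ ← t (s z) (inj₁ (cycle₂ l refl)) with nbr₂ l h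
    ... | apex k e = moved-2 l (trans (adj₀₂ k l⁺ (swap h′)) (sym e))
      where l⁺ = trans (lev-s z) l
    ... | over k e = moved-2 l (trans (adj₁₂ k l⁺ (swap h′)) (sym e))
      where l⁺ = trans (lev-s z) l
    ... | next k refl = irreflexive h′
    ... | below k refl = ~-movedʳ h (trans (sym (p-s z)) (sym (adj₂₃ (trans (lev-s z) l) k h′)))
    ... | prev k refl with adj₂₂ (trans (lev-s z) l) k h′
    ...   | inj₁ e = s³-2 k (sym e)
    ...   | inj₂ e = moved-2 k (s-injective e)

    -- The edge from `w` to a preimage `v` lies in no triangle. A third vertex after the layer of
    -- `w` is too far from `v`; one in the layer of `v` has the same image `w`, while adjacent
    -- vertices of layer 2 have different images and later layers have no inner edges.
    ¬triangles₃ : ∀ {w k} → lev w ≡ 3 + k → Moved w → ¬ EdgesInTriangles w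
    ¬triangles₃ {w} {k} l mw t with v , v₂ , refl ← preimage l
      with u , h , h′ ← t v (inj₂ (down (trans l (cong suc (sym v₂))) refl mw)) = triangle k l v₂ (nbr₃ l h) h′
      where
      triangle : ∀ k → lev (p v) ≡ 3 + k → lev v ≡ 2 + k → Nbr₃ k (p v) u → ¬ v ~ u
      triangle zero l v₂ (below k′ refl) h′ with nbr₂ v₂ h′
      ... | apex  c _ = clash u c k′ λ ()
      ... | over  c _ = clash u c k′ λ ()
      ... | next  c _ = clash u c k′ λ ()
      ... | prev  c _ = clash u c k′ λ ()
      ... | below c _ = clash u c k′ λ ()
      triangle zero l v₂ (over k′ e) h′ with adj₂₂ v₂ k′ h′
      ... | inj₁ refl = mw (trans (sym (p-s v)) (sym e))
      ... | inj₂ refl = mw (trans (cong s e) (trans (sym (p-s u)) refl))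
      triangle (suc k) l v₂ (below k′ _) h′ with nbr₃ v₂ h′
      ... | over  c _ = clash u c k′ (<⇒≢ (m≤n⇒m≤1+n (m≤n⇒m≤1+n ≤-refl)))
      ... | below c _ = clash u c k′ (<⇒≢ ≤-refl)
      triangle (suc k) l v₂ (over k′ _) h′ with nbr₃ v₂ h′
      ... | over  c _ = clash u c k′ (<⇒≢ ≤-refl)
      ... | below c _ = clash u k′ c (<⇒≢ ≤-refl)

    module _ (φ : LocalAut edge Moved) where
      open Automorphism φ

      to-triangles : ∀ {v} → EdgesInTriangles v → EdgesInTriangles (to v)
      to-triangles t u h with w , h₁ , h₂ ← t (from u) (to-~-from φ h) =
        to w , to-~ h₁ , subst (_~ to w) (to∘from u) (to-~ h₂)

      to-thin : ∀ {v} → ThinTriangle v → ThinTriangle (to v)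
      to-thin (a , b , h , h′ , h″ , only-b , only-a) =
        to a , to b , to-~ h , to-~ h′ , to-~ h″ ,
        (λ u k k′ → trans (sym (to∘from u)) (cong to (only-b (from u) (to-~-from φ k) (to-~-from φ k′)))) ,
        (λ u k k′ → trans (sym (to∘from u)) (cong to (only-a (from u) (to-~-from φ k) (to-~-from φ k′))))

      to-layer-0 : ∀ {x} → lev x ≡ 0 → lev (to x) ≡ 0
      to-layer-0 {x} l with a , refl ← s-surjective x with lev (to (s a)) in e
      ... | 0 = refl
      ... | 1 = contradiction (to-thin (thin₀ (trans (sym (lev-s a)) l))) (¬thin₁ e)
      ... | 2 = contradiction (to-triangles (triangles₀ l)) (¬triangles₂ e)
      ... | suc (suc (suc k)) = contradiction (to-triangles (triangles₀ l)) (¬triangles₃ e (to-U (moved-0 l)))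

    module _ (φ : LocalAut edge Moved) where
      open Automorphism φ

      from-layer-0 : ∀ {v} → lev (to v) ≡ 0 → lev v ≡ 0
      from-layer-0 {v} l = trans (cong lev (sym (from∘to v))) (to-layer-0 (inverse φ) l)

      -- Among the neighbours of x outside layer 0, only p x and p (p x) are
      -- adjacent; s x is adjacent to the former but not to the latter.
      fixed-star : ∀ {x} → lev x ≡ 0 → to x ≡ x →
                   to (s x) ≡ s x × to (p x) ≡ p x × to (p (p x)) ≡ p (p x)
      fixed-star {x} l e with nbr₀ l (subst (_~ to (p x)) e (to-~ (~p l)))
      ... | next k _ = clash (p x) (p-0 l) (from-layer-0 k) λ ()
      ... | prev k _ = clash (p x) (p-0 l) (from-layer-0 k) λ ()
      -- If `p x` went to `σ⁻¹ (p x)`, the image of `p (p x)` would be adjacent both to that vertex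
      -- and to `x`, but their neighbours in layer 2 differ by `σ`.
      ... | mid⁻ k e′ with nbr₁ k (to-~ (~p₁ (p-0 l)))
      ...   | over  c _ = clash (p (p x)) (p-1 (p-0 l)) (from-layer-0 c) λ ()
      ...   | over⁺ c _ = clash (p (p x)) (p-1 (p-0 l)) (from-layer-0 c) λ ()
      ...   | below c q = contradiction
              (trans (sym (p-s _)) (trans (cong p e′) (trans (sym (adj₀₂ l c z′~x)) q))) (moved-2 (p-1 k))
        where z′~x = subst (_~ to (p (p x))) e (to-~ (~pp l))
      -- If `p x` went to `p (p x)`, the image of `s x`, which is next to `x` on the cycle, would be
      -- adjacent to `p (p x)`; its only neighbour in layer 2 is a shift of that.
      fixed-star {x} l e | tip k e′ with adj₀₀ l x′₀ (subst (_~ to (s x)) e (to-~ (~next l)))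
        where x′₀ = to-layer-0 φ (trans (lev-s x) l)
      ... | inj₁ q = contradiction (trans (cong s e′) (trans (sym (pp-s x)) (trans (cong (p ∘ p) (sym q)) (sym same)))) (moved-2 k)
        where same = adj₀₂ (to-layer-0 φ (trans (lev-s x) l)) k (to-~ (~p⁻ (trans (lev-s x) l) (sym (p-s x))))
      ... | inj₂ q = contradiction (trans (cong s same) (trans (sym (pp-s _)) (trans (cong (p ∘ p) (sym q)) (sym e′)))) (moved-2 k)
        where same = adj₀₂ (to-layer-0 φ (trans (lev-s x) l)) k (to-~ (~p⁻ (trans (lev-s x) l) (sym (p-s x))))
      fixed-star {x} l e | mid k e′ = to-s , e′ , to-pp
        where
        x′₀ = to-layer-0 φ (trans (lev-s x) l)
        x′~px : to (s x) ~ p x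
        x′~px = subst (to (s x) ~_) e′ (to-~ (~p⁻ (trans (lev-s x) l) (sym (p-s x))))
        to-s : to (s x) ≡ s x
        to-s with adj₀₀ l x′₀ (subst (_~ to (s x)) e (to-~ (~next l)))
        ... | inj₁ q = q
        -- The predecessor of `x` is joined in layer 1 to `σ⁻¹ (p x)` and `σ⁻² (p x)` only, and
        -- neither equals `p x`.
        ... | inj₂ q with px≡ ← trans (cong p q) (p-s _) with adj₀₁ x′₀ (p-0 l) x′~px
        ...   | inj₁ r = contradiction (trans (cong s r) (sym px≡)) (moved-1 (p-0 l))
        ...   | inj₂ r = contradiction (trans (cong s r) (sym px≡)) (s²-1 (p-0 l))
        to-pp : to (p (p x)) ≡ p (p x)
        to-pp with nbr₁ (p-0 l) (subst (_~ to (p (p x))) e′ (to-~ (~p₁ (p-0 l))))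
        ... | over  c _ = clash (p (p x)) (p-1 (p-0 l)) (from-layer-0 c) λ ()
        ... | over⁺ c _ = clash (p (p x)) (p-1 (p-0 l)) (from-layer-0 c) λ ()
        ... | below _ q = q

      -- For the induction over layers: the image of `p u` is adjacent to the fixed vertex `u`, so
      -- it is `p u` itself or lies in a layer already known to be fixed.
      up-or-lower : ∀ k {u w} → lev u ≡ 2 + k → u ~ w → w ≡ p u ⊎ lev w ≤ 2 + k
      up-or-lower zero {u} {w} l h with nbr₂ l h
      ... | apex  k _ = inj₂ (≤-trans (≤-reflexive k) z≤n)
      ... | over  k _ = inj₂ (≤-trans (≤-reflexive k) (n≤1+n _))
      ... | next  k _ = inj₂ (≤-reflexive k)
      ... | prev  k _ = inj₂ (≤-reflexive k)
      ... | below _ e = inj₁ e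
      up-or-lower (suc k) l h with nbr₃ l h
      ... | over  k′ _ = inj₂ (≤-trans (≤-reflexive k′) (n≤1+n _))
      ... | below _ e  = inj₁ e

      module _ {x : Fin m} (l : lev x ≡ 0) (e : to x ≡ x) where

        fixed₀ : ∀ {v} → lev v ≡ 0 → to v ≡ v
        fixed₀ = layer-fixed l e (λ l e → proj₁ (fixed-star l e))

        next-layer : ∀ k → (∀ {v} → lev v ≤ k → Moved v → to v ≡ v) →
                     ∀ {v} → lev v ≡ suc k → Moved v → to v ≡ v
        next-layer k ih v≡ mv with preimage v≡
        next-layer 0 ih v≡ mv | u , u₀ , refl = proj₁ (proj₂ (fixed-star u₀ (fixed₀ u₀)))
        next-layer 1 ih v≡ mv | u , u₁ , refl with w , w₀ , refl ← preimage u₁ =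
          proj₂ (proj₂ (fixed-star w₀ (fixed₀ w₀)))
        next-layer (suc (suc k)) ih v≡ mv | u , uₖ , refl
          with fu ← ih (≤-reflexive uₖ) (λ e → mv (trans (sym (p-s u)) (cong p e)))
          with up-or-lower k uₖ (subst (_~ to (p u)) fu (to-~ (inj₁ (down (trans v≡ (cong suc (sym uₖ))) refl mv))))
        ... | inj₁ q = q
        -- The image of `p u` is then itself a fixed vertex, so by injectivity it is `p u`.
        ... | inj₂ q = to-injective (ih q (to-U mv))

        fixed : ∀ k {v} → lev v ≤ k → Moved v → to v ≡ v
        fixed zero    v≤ mv = fixed₀ (n≤0⇒n≡0 v≤)
        fixed (suc k) v≤ mv with m≤n⇒m<n∨m≡n v≤
        ... | inj₁ v< = fixed k (ℕ.s≤s⁻¹ v<) mv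
        ... | inj₂ v≡ = next-layer k (fixed k) v≡ mv

    rigid : Rigid σ 2 Moved
    rigid with y , y₁ , _ ← y₀ with x , x₀ , _ ← preimage y₁ =
      stabiliser⇒rigid edge edge-symmetric edge-invariant x₀ to-layer-0 (λ φ l e v → fixed φ l e (lev v) ≤-refl)

-- Two nontrivial orbits

module TwoOrbits {m : ℕ} {σ : Permutation′ m} (L : Layers σ) {M : ℕ} (σ^N : IsIdPower σ (suc M)) where
  open Layered L {M} σ^N

  module _ (period : ∀ {v} → lev v ≡ 1 → PeriodMultipleOf σ 8 v)
           {y₀ : Fin m} (y₀-layer : lev y₀ ≡ 1) (top : ∀ {v} → Moved v → lev v ≤ 1) where

    p-0 : ∀ {x} → lev x ≡ 0 → lev (p x) ≡ 1
    p-0 = p-layer y₀-layer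

    moved-1 : ∀ {y} → lev y ≡ 1 → Moved y
    moved-1 l e = from-no (8 ∣? 1) (period l 1 e)

    moved-0 : ∀ {x} → lev x ≡ 0 → Moved x
    moved-0 {x} l e = moved-1 (p-0 l) (trans (sym (p-s x)) (cong p e))

    -- The offsets 0 and 1 are consecutive, so their edges form triangles with `x — σ x`; 3 has no
    -- neighbour among the offsets. No two offsets differ by 4 modulo 8, which keeps `y — σ⁴ y` out
    -- of triangles. Finally 3 - 2 is an offset and 3 + 2 is not, which determines an orientation.
    offset : Fin 3 → ℕ
    offset zero             = 0
    offset (suc zero)       = 1
    offset (suc (suc zero)) = 3

    pattern cycle₀ l e = inj₁ (l , e)
    pattern link l i e = inj₂ (inj₁ (l , i , e))
    pattern cycle₁ l e = inj₂ (inj₂ (l , e))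

    infix 4 _⇒_ _⇒?_
    _⇒_ : Fin m → Fin m → Set
    u ⇒ v = (lev u ≡ 0 × v ≡ s u)
          ⊎ (lev u ≡ 0 × ∃ λ i → pow σ (offset i) v ≡ p u)
          ⊎ (lev u ≡ 1 × v ≡ pow σ 4 u)

    _⇒?_ : ∀ u v → Dec (u ⇒ v)
    u ⇒? v = ((lev u ℕ.≟ 0) ×-dec (v Fin.≟ s u))
       ⊎-dec ((lev u ℕ.≟ 0) ×-dec Fin.any? (λ i → pow σ (offset i) v Fin.≟ p u))
       ⊎-dec ((lev u ℕ.≟ 1) ×-dec (v Fin.≟ pow σ 4 u))

    link-1 : ∀ {u v} i → lev u ≡ 0 → pow σ i v ≡ p u → lev v ≡ 1
    link-1 {u} {v} i l e = trans (sym (lev-pow i v)) (trans (cong lev e) (p-0 l))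

    ⇒-s : ∀ {u v} → u ⇒ v → s u ⇒ s v
    ⇒-s {u} (cycle₀ l refl) = cycle₀ (trans (lev-s u) l) refl
    ⇒-s {u} {v} (link l i e) = link (trans (lev-s u) l) i (trans (pow-comm (offset i) 1 v) (trans (cong s e) (sym (p-s u))))
    ⇒-s {u} (cycle₁ l refl) = cycle₁ (trans (lev-s u) l) refl

    ⇒-s⁻ : ∀ {u v} → s u ⇒ s v → u ⇒ v
    ⇒-s⁻ {u} (cycle₀ l e) = cycle₀ (trans (sym (lev-s u)) l) (s-injective e)
    ⇒-s⁻ {u} {v} (link l i e) = link (trans (sym (lev-s u)) l) i
      (s-injective (trans (sym (pow-comm (offset i) 1 v)) (trans e (p-s u))))
    ⇒-s⁻ {u} (cycle₁ l e) = cycle₁ (trans (sym (lev-s u)) l) (s-injective e)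

    ⇒-irreflexive : ∀ {u} → ¬ u ⇒ u
    ⇒-irreflexive (cycle₀ l e) = moved-0 l (sym e)
    ⇒-irreflexive {u} (link l i e) = clash u l (link-1 (offset i) l e) λ ()
    ⇒-irreflexive (cycle₁ l e) = from-no (8 ∣? 4) (period l 4 (sym e))

    ⇒-moved : ∀ {u v} → u ⇒ v → Moved u × Moved v
    ⇒-moved (cycle₀ l refl) = moved-0 l , moved-0 l ∘ s-injective
    ⇒-moved (link l i e)    = moved-0 l , moved-1 (link-1 (offset i) l e)
    ⇒-moved (cycle₁ l refl) = moved-1 l , Moved-pow 4 (moved-1 l)

    open Graph _⇒_ _⇒?_ ⇒-s ⇒-s⁻ ⇒-irreflexive ⇒-moved

    data Nbr₀ (x u : Fin m) : Set where
      next  : lev u ≡ 0 → u ≡ s x → Nbr₀ x u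
      prev  : lev u ≡ 0 → x ≡ s u → Nbr₀ x u
      below : lev u ≡ 1 → ∀ i → pow σ (offset i) u ≡ p x → Nbr₀ x u

    nbr₀ : ∀ {x u} → lev x ≡ 0 → x ~ u → Nbr₀ x u
    nbr₀ {x} l (inj₁ (cycle₀ _ refl)) = next (trans (lev-s x) l) refl
    nbr₀ l (inj₁ (link _ i e)) = below (link-1 (offset i) l e) i e
    nbr₀ {x} l (inj₁ (cycle₁ l′ e)) = clash x l l′ λ ()
    nbr₀ l (inj₂ (cycle₀ l′ e)) = prev l′ e
    nbr₀ {x} l (inj₂ (link l′ i e)) = clash x l (link-1 (offset i) l′ e) λ ()
    nbr₀ {x} {u} l (inj₂ (cycle₁ l′ refl)) = clash x l (trans (lev-pow 4 u) l′) λ ()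

    data Nbr₁ (y u : Fin m) : Set where
      over : lev u ≡ 0 → ∀ i → pow σ (offset i) y ≡ p u → Nbr₁ y u
      next : lev u ≡ 1 → u ≡ pow σ 4 y → Nbr₁ y u
      prev : lev u ≡ 1 → y ≡ pow σ 4 u → Nbr₁ y u

    nbr₁ : ∀ {y u} → lev y ≡ 1 → y ~ u → Nbr₁ y u
    nbr₁ {y} l (inj₁ (cycle₀ l′ _)) = clash y l l′ λ ()
    nbr₁ {y} l (inj₁ (link l′ _ _)) = clash y l l′ λ ()
    nbr₁ {y} l (inj₁ (cycle₁ _ refl)) = next (trans (lev-pow 4 y) l) refl
    nbr₁ {y} {u} l (inj₂ (cycle₀ l′ refl)) = clash y l (trans (lev-s u) l′) λ ()
    nbr₁ l (inj₂ (link l′ i e)) = over l′ i e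
    nbr₁ l (inj₂ (cycle₁ l′ e)) = prev l′ e

    adj₀₀ : ∀ {x u} → lev x ≡ 0 → lev u ≡ 0 → x ~ u → u ≡ s x ⊎ x ≡ s u
    adj₀₀ {u = u} l l′ h with nbr₀ l h
    ... | next _ e    = inj₁ e
    ... | prev _ e    = inj₂ e
    ... | below k _ _ = clash u k l′ λ ()

    adj₁₀ : ∀ {y u} → lev y ≡ 1 → lev u ≡ 0 → y ~ u → ∃ λ i → pow σ (offset i) y ≡ p u
    adj₁₀ {u = u} l l′ h with nbr₁ l h
    ... | over _ i e = i , e
    ... | next k _ = clash u k l′ λ ()
    ... | prev k _ = clash u k l′ λ ()

    adj₁₁ : ∀ {y u} → lev y ≡ 1 → lev u ≡ 1 → y ~ u → u ≡ pow σ 4 y ⊎ y ≡ pow σ 4 u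
    adj₁₁ {u = u} l l′ h with nbr₁ l h
    ... | over k _ _ = clash u k l′ λ ()
    ... | next _ e = inj₁ e
    ... | prev _ e = inj₂ e

    ~next : ∀ {x} → lev x ≡ 0 → x ~ s x
    ~next l = inj₁ (cycle₀ l refl)

    ~link : ∀ {x u} i → lev x ≡ 0 → pow σ (offset i) u ≡ p x → x ~ u
    ~link i l e = inj₁ (link l i e)

    apart : ∀ {y} a b → ¬ (8 ∣ ∣ a - b ∣) → lev y ≡ 1 → pow σ a y ≢ pow σ b y
    apart a b n l e = n (residue (period l) a b e)

    pattern 0F = zero
    pattern 1F = suc zero
    pattern 3F = suc (suc zero)

    Lone : Fin m → Fin m → Set
    Lone v u = v ~ u × (∀ w → v ~ w → ¬ u ~ w)

    lone-swap : ∀ {v u} → Lone v u → Lone u v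
    lone-swap (h , n) = swap h , λ w k k′ → n w k′ k

    -- The cycle edges and those of offsets 0 and 1 are the sides of the triangles `x, s x, p x`.
    -- Only offset 3 remains.
    lone₀ : ∀ {x u} → lev x ≡ 0 → Lone x u → pow σ 3 u ≡ p x
    lone₀ {x} {u} l (h , n) with nbr₀ l h
    ... | next k refl     = contradiction (~link 1F k (sym (p-s x))) (n (p x) (~link 0F l refl))
    ... | prev k refl = contradiction (~link 0F k refl) (n (p u) (~link 1F l (sym (p-s u))))
    ... | below k 0F refl = contradiction (swap (~link 1F (trans (lev-s x) l) (sym (p-s x)))) (n (s x) (~next l))
    ... | below k 3F e    = e
    lone₀ {x} {u} l (h , n) | below k 1F e with a , refl ← s-surjective x =
      contradiction (swap (~link 0F (trans (sym (lev-s a)) l) (s-injective (trans e (p-s a)))))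
                    (n a (swap (~next (trans (sym (lev-s a)) l))))

    -- A third vertex in layer 0 would give two offsets differing by 4 modulo 8. One in layer 1
    -- would close a 3-cycle of `σ⁴`, so that `σ¹²` fixes a vertex of period divisible by 8.
    lone₁₁ : ∀ {y} → lev y ≡ 1 → Lone y (pow σ 4 y)
    lone₁₁ {y} l = inj₁ (cycle₁ l refl) , no-common
      where
      l⁺ = trans (lev-pow 4 y) l
      offsets : ∀ i j → ¬ (8 ∣ ∣ offset i - (offset j + 4) ∣)
      offsets = from-yes (Fin.all? λ i → Fin.all? λ j → ¬? (8 ∣? ∣ offset i - (offset j + 4) ∣))
      no-common : ∀ w → y ~ w → ¬ pow σ 4 y ~ w
      no-common w h h′ with nbr₁ l h
      ... | next k refl = irreflexive h′
      ... | over k i e with j , e′ ← adj₁₀ l⁺ k h′ =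
            apart (offset i) (offset j + 4) (offsets i j) l (trans e (trans (sym e′) (sym (pow-+ (offset j) 4 y))))
      ... | prev k e with adj₁₁ l⁺ k h′
      ...   | inj₁ refl = apart 0 12 (from-no (8 ∣? 12)) l e
      ...   | inj₂ e′ with refl ← pow-injective 4 {y} {w} e′ = irreflexive h

    -- With `s x`, the predecessor of `x`, or a neighbour of `y` in layer 1 as third vertex, the
    -- offset of the third side would be 4, 2 or 7 modulo 8.
    lone₁₀ : ∀ {y x} → lev y ≡ 1 → lev x ≡ 0 → pow σ 3 y ≡ p x → Lone y x
    lone₁₀ {y} {x} l l₀ e = swap (~link 3F l₀ e) , no-common
      where
      offsets₄ : ∀ i → ¬ (8 ∣ ∣ offset i - 4 ∣)
      offsets₄ = from-yes (Fin.all? λ i → ¬? (8 ∣? ∣ offset i - 4 ∣))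
      offsets₂ : ∀ i → ¬ (8 ∣ ∣ offset i - 2 ∣)
      offsets₂ = from-yes (Fin.all? λ i → ¬? (8 ∣? ∣ offset i - 2 ∣))
      offsets₃ : ∀ i → ¬ (8 ∣ ∣ offset i + 4 - 3 ∣)
      offsets₃ = from-yes (Fin.all? λ i → ¬? (8 ∣? ∣ offset i + 4 - 3 ∣))
      offsets₇ : ∀ i → ¬ (8 ∣ ∣ offset i - 7 ∣)
      offsets₇ = from-yes (Fin.all? λ i → ¬? (8 ∣? ∣ offset i - 7 ∣))
      no-common : ∀ w → y ~ w → ¬ x ~ w
      no-common w h h′ with nbr₀ l₀ h′
      ... | next k refl with i , e′ ← adj₁₀ l k h =
            apart (offset i) 4 (offsets₄ i) l (trans e′ (trans (p-s x) (cong s (sym e))))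
      ... | prev k refl with i , e′ ← adj₁₀ l k h =
            apart (offset i) 2 (offsets₂ i) l (trans e′ (s-injective (trans (sym (p-s w)) (sym e))))
      ... | below k i e′ with adj₁₁ l k h
      ...   | inj₁ refl = apart (offset i + 4) 3 (offsets₃ i) l (trans (pow-+ (offset i) 4 y) (trans e′ (sym e)))
      ...   | inj₂ refl = apart (offset i) 7 (offsets₇ i) k (trans e′ (sym e))

    -- A vertex of layer 0 has one edge outside all triangles, a vertex of layer 1 has several.
    UniqueLone : Fin m → Set
    UniqueLone v = ∀ u w → Lone v u → Lone v w → u ≡ w

    uniqueLone₀ : ∀ {x} → lev x ≡ 0 → UniqueLone x
    uniqueLone₀ l _ _ h h′ = pow-injective 3 (trans (lone₀ l h) (sym (lone₀ l h′)))

    above : ∀ {y} → lev y ≡ 1 → ∃ λ x → lev x ≡ 0 × pow σ 3 y ≡ p x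
    above l with x , x₀ , refl ← preimage l = pow σ 3 x , trans (lev-pow 3 x) x₀ ,
      sym (trans (p-s _) (cong s (trans (p-s _) (cong s (p-s _)))))

    ¬uniqueLone₁ : ∀ {y} → lev y ≡ 1 → ¬ UniqueLone y
    ¬uniqueLone₁ {y} l unique with x , x₀ , e ← above l =
      clash x x₀ (trans (cong lev (unique _ _ (lone₁₀ l x₀ e) (lone₁₁ l))) (trans (lev-pow 4 y) l)) λ ()

    to-lone : (φ : LocalAut edge Moved) → ∀ {v u} → Lone v u → Lone (LocalAut.to φ v) (LocalAut.to φ u)
    to-lone φ (h , n) = to-~ h , λ w k k′ → n (from w) (to-~-from φ k) (to-~-from φ k′)
      where open Automorphism φ

    to-layer-0 : (φ : LocalAut edge Moved) → ∀ {x} → lev x ≡ 0 → lev (LocalAut.to φ x) ≡ 0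
    to-layer-0 φ {x} l with lev (to x) in e | top (to-U (moved-0 l))
      where open Automorphism φ
    ... | 0 | _ = refl
    ... | suc (suc _) | s≤s ()
    ... | 1 | _ = contradiction
      (λ u w h h′ → from-injective (uniqueLone₀ l _ _ (pull h) (pull h′))) (¬uniqueLone₁ e)
      where
      open Automorphism φ
      from-injective = LocalAut.to-injective (inverse φ)
      pull : ∀ {u} → Lone (to x) u → Lone x (from u)
      pull {u} h = subst (λ v → Lone v (from u)) (from∘to x) (to-lone (inverse φ) h)

    module _ (φ : LocalAut edge Moved) where
      open Automorphism φ

      fixed-lone : ∀ {x u} → lev x ≡ 0 → to x ≡ x → pow σ 3 u ≡ p x → to u ≡ u
      fixed-lone {x} {u} l e q = uniqueLone₀ l _ _ (subst (λ v → Lone v (to u)) e (to-lone φ h)) h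
        where h = lone-swap (lone₁₀ (link-1 3 l q) l q)

      -- Excludes a reflection about the fixed vertex `x = s a`. Let `a = s b`. The lone neighbour
      -- `y` of `x` in layer 1 is fixed, and is joined to `b` with offset 3 - 2 = 1. If `a` went to
      -- `s x`, then `b` would go to `x`, against injectivity, or to `σ² x`, which is joined to `y`
      -- only if 3 + 2 = 5 is an offset modulo 8.
      fixed-prev : ∀ {a} → lev (s a) ≡ 0 → to (s a) ≡ s a → to a ≡ a
      fixed-prev {a} l e with b , refl ← s-surjective a with adj₀₀ l (to-layer-0 φ (trans (sym (lev-s _)) l))
                              (subst (_~ to (s b)) e (to-~ (swap (~next (trans (sym (lev-s _)) l)))))
      ... | inj₂ q = sym (s-injective q)
      ... | inj₁ q = ⊥-elim bad
        where
        b₀ : lev b ≡ 0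
        b₀ = trans (sym (lev-pow 2 b)) l
        c : ∃ λ c → s c ≡ p b
        c = _ , sym (proj₂ (s-surjective (p b)))
        y = proj₁ c
        y₁ : lev y ≡ 1
        y₁ = link-1 1 b₀ (proj₂ c)
        y-far : pow σ 3 y ≡ p (s (s b))
        y-far = trans (cong (s ∘ s) (proj₂ c)) (sym (trans (p-s _) (cong s (p-s b))))
        to-b₀ : lev (to b) ≡ 0
        to-b₀ = to-layer-0 φ b₀
        far : ∀ i → ¬ (8 ∣ ∣ offset i - 5 ∣)
        far = from-yes (Fin.all? λ i → ¬? (8 ∣? ∣ offset i - 5 ∣))
        y~to-b : y ~ to b
        y~to-b = subst (_~ to b) (fixed-lone l e y-far) (to-~ (swap (~link 1F b₀ (proj₂ c))))
        bad : ⊥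
        bad with adj₀₀ (trans (lev-s _) l) to-b₀ (subst (_~ to b) q (to-~ (swap (~next b₀))))
        ... | inj₁ r with i , r′ ← adj₁₀ y₁ to-b₀ y~to-b = apart (offset i) 5 (far i) y₁
                (trans r′ (trans (cong p r) (trans (p-s _) (cong s (trans (p-s _) (cong s (sym y-far)))))))
        ... | inj₂ r = apart 0 2 (from-no (8 ∣? 2)) (p-0 b₀)
                (trans (cong p (to-injective (trans (sym (s-injective r)) (sym e)))) (trans (p-s _) (cong s (p-s b))))

      fixed-layer-0 : ∀ {x} → lev x ≡ 0 → to x ≡ x → ∀ {v} → lev v ≡ 0 → to v ≡ v
      -- `x` is expressed as a power of `σ` at `v`, not conversely, because `fixed-prev` steps
      -- against `σ`.
      fixed-layer-0 {x} l e k with j , q ← transitive (trans k (sym l)) = back j k (subst (λ t → to t ≡ t) q e)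
        where
        back : ∀ j {v} → lev v ≡ 0 → to (pow σ j v) ≡ pow σ j v → to v ≡ v
        back zero    k e = e
        back (suc j) k e = back j k (fixed-prev (trans (lev-pow (suc j) _) k) e)

      fixed : ∀ {x} → lev x ≡ 0 → to x ≡ x → ∀ v → Moved v → to v ≡ v
      fixed {x} l e v mv with lev v in k | top mv
      ... | 0 | _ = fixed-layer-0 l e k
      ... | 1 | _ with x′ , x′₀ , q ← above k = fixed-lone x′₀ (fixed-layer-0 l e x′₀) q
      ... | suc (suc _) | s≤s ()

    rigid : Rigid σ 2 Moved
    rigid with x , x₀ , _ ← preimage y₀-layer =
      stabiliser⇒rigid edge edge-symmetric edge-invariant x₀ to-layer-0 fixed

-- Two nontrivial orbits: three colours

module TwoOrbitsThreeColours {m : ℕ} {σ : Permutation′ m} (L : Layers σ) {M : ℕ} (σ^N : IsIdPower σ (suc M)) where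
  open Layered L {M} σ^N

  module _ (period : ∀ {v} → lev v ≡ 1 → PeriodMultipleOf σ 4 v)
           {y₀ : Fin m} (y₀-layer : lev y₀ ≡ 1) (top : ∀ {v} → Moved v → lev v ≤ 1) where

    p-0 : ∀ {x} → lev x ≡ 0 → lev (p x) ≡ 1
    p-0 = p-layer y₀-layer

    moved-1 : ∀ {y} → lev y ≡ 1 → Moved y
    moved-1 l e = from-no (4 ∣? 1) (period l 1 e)

    moved-0 : ∀ {x} → lev x ≡ 0 → Moved x
    moved-0 {x} l e = moved-1 (p-0 l) (trans (sym (p-s x)) (cong p e))

    s²-1 : ∀ {y} → lev y ≡ 1 → s (s y) ≢ y
    s²-1 l e = from-no (4 ∣? 2) (period l 2 e)

    infix 4 _⇒₁_ _⇒₂_ _~₁_ _~₂_ _~₁?_ _~₂?_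
    -- Joining `x` to `p x` and to `σ⁻¹ (p x)` in different colours breaks the reflection that
    -- exchanges these two vertices.
    _⇒₁_ _⇒₂_ _~₁_ _~₂_ : Fin m → Fin m → Set
    u ⇒₁ v = (lev u ≡ 0 × v ≡ s u) ⊎ (lev u ≡ 0 × v ≡ p u)
    u ⇒₂ v = (lev u ≡ 0 × s v ≡ p u) ⊎ (lev u ≡ 1 × v ≡ s u)
    u ~₁ v = u ⇒₁ v ⊎ v ⇒₁ u
    u ~₂ v = u ⇒₂ v ⊎ v ⇒₂ u

    _~₁?_ : ∀ u v → Dec (u ~₁ v)
    u ~₁? v = ⇒? u v ⊎-dec ⇒? v u
      where
      ⇒? : ∀ u v → Dec (u ⇒₁ v)
      ⇒? u v = ((lev u ℕ.≟ 0) ×-dec (v Fin.≟ s u)) ⊎-dec ((lev u ℕ.≟ 0) ×-dec (v Fin.≟ p u))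

    _~₂?_ : ∀ u v → Dec (u ~₂ v)
    u ~₂? v = ⇒? u v ⊎-dec ⇒? v u
      where
      ⇒? : ∀ u v → Dec (u ⇒₂ v)
      ⇒? u v = ((lev u ℕ.≟ 0) ×-dec (s v Fin.≟ p u)) ⊎-dec ((lev u ℕ.≟ 1) ×-dec (v Fin.≟ s u))

    skew-0 : ∀ {u v} → lev u ≡ 0 → s v ≡ p u → lev v ≡ 1
    skew-0 {u} {v} l e = trans (sym (lev-s v)) (trans (cong lev e) (p-0 l))

    ⇒₁-s : ∀ {u v} → u ⇒₁ v → s u ⇒₁ s v
    ⇒₁-s {u} (inj₁ (l , refl)) = inj₁ (trans (lev-s u) l , refl)
    ⇒₁-s {u} (inj₂ (l , refl)) = inj₂ (trans (lev-s u) l , sym (p-s u))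

    ⇒₁-s⁻ : ∀ {u v} → s u ⇒₁ s v → u ⇒₁ v
    ⇒₁-s⁻ {u} (inj₁ (l , e)) = inj₁ (trans (sym (lev-s u)) l , s-injective e)
    ⇒₁-s⁻ {u} (inj₂ (l , e)) = inj₂ (trans (sym (lev-s u)) l , s-injective (trans e (p-s u)))

    ⇒₂-s : ∀ {u v} → u ⇒₂ v → s u ⇒₂ s v
    ⇒₂-s {u} (inj₁ (l , e))    = inj₁ (trans (lev-s u) l , trans (cong s e) (sym (p-s u)))
    ⇒₂-s {u} (inj₂ (l , refl)) = inj₂ (trans (lev-s u) l , refl)

    ⇒₂-s⁻ : ∀ {u v} → s u ⇒₂ s v → u ⇒₂ v
    ⇒₂-s⁻ {u} (inj₁ (l , e)) = inj₁ (trans (sym (lev-s u)) l , s-injective (trans e (p-s u)))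
    ⇒₂-s⁻ {u} (inj₂ (l , e)) = inj₂ (trans (sym (lev-s u)) l , s-injective e)

    ⇒-disjoint : ∀ {u v} → u ⇒₁ v → ¬ u ⇒₂ v
    ⇒-disjoint {u} (inj₁ (l , refl)) (inj₁ (_ , e)) = clash (s u) (trans (lev-s u) l) (skew-0 l e) λ ()
    ⇒-disjoint {u} (inj₂ (l , refl)) (inj₁ (_ , e)) = moved-1 (p-0 l) e
    ⇒-disjoint {u} (inj₁ (l , _)) (inj₂ (l′ , _)) = clash u l l′ λ ()
    ⇒-disjoint {u} (inj₂ (l , _)) (inj₂ (l′ , _)) = clash u l l′ λ ()

    ⇒-disjoint′ : ∀ {u v} → u ⇒₁ v → ¬ v ⇒₂ u
    ⇒-disjoint′ {u} (inj₁ (l , _)) (inj₁ (l′ , e)) = clash u l (skew-0 l′ e) λ ()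
    ⇒-disjoint′ {u} (inj₂ (l , _)) (inj₁ (l′ , e)) = clash u l (skew-0 l′ e) λ ()
    ⇒-disjoint′ {u} (inj₁ (l , refl)) (inj₂ (l′ , e)) = clash (s u) (trans (lev-s u) l) l′ λ ()
    ⇒-disjoint′ {u} (inj₂ (l , refl)) (inj₂ (l′ , e)) = clash u l (trans (cong lev e) (trans (lev-s _) l′)) λ ()

    disjoint : ∀ {u v} → u ~₁ v → ¬ u ~₂ v
    disjoint (inj₁ h) (inj₁ k) = ⇒-disjoint h k
    disjoint (inj₁ h) (inj₂ k) = ⇒-disjoint′ h k
    disjoint (inj₂ h) (inj₁ k) = ⇒-disjoint′ h k
    disjoint (inj₂ h) (inj₂ k) = ⇒-disjoint h k

    -- Colour 1 takes precedence, which is harmless because of `disjoint`.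
    trit : ∀ {A B : Set} → Dec A → Dec B → Fin 3
    trit (yes _) _       = suc zero
    trit (no _)  (yes _) = suc (suc zero)
    trit (no _)  (no _)  = zero

    trit-1 : ∀ {A B : Set} (a? : Dec A) (b? : Dec B) → A → trit a? b? ≡ suc zero
    trit-1 (yes _) _ a = refl
    trit-1 (no n)  _ a = contradiction a n

    trit-2 : ∀ {A B : Set} (a? : Dec A) (b? : Dec B) → ¬ A → B → trit a? b? ≡ suc (suc zero)
    trit-2 (yes a) _       n b = contradiction a n
    trit-2 (no _)  (yes _) n b = refl
    trit-2 (no _)  (no ¬b) n b = contradiction b ¬b

    trit-1⁻ : ∀ {A B : Set} (a? : Dec A) (b? : Dec B) → trit a? b? ≡ suc zero → A
    trit-1⁻ (yes a) _      _ = a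
    trit-1⁻ (no _) (yes _) ()
    trit-1⁻ (no _) (no _)  ()

    trit-2⁻ : ∀ {A B : Set} (a? : Dec A) (b? : Dec B) → trit a? b? ≡ suc (suc zero) → B
    trit-2⁻ (no _) (yes b) _ = b
    trit-2⁻ (no _) (no _)  ()

    trit-cong : ∀ {A B A′ B′ : Set} (a? : Dec A) (b? : Dec B) (a′? : Dec A′) (b′? : Dec B′) →
                (A → A′) → (A′ → A) → (B → B′) → (B′ → B) → trit a? b? ≡ trit a′? b′?
    trit-cong (yes a) b? a′? b′? f g h k = sym (trit-1 a′? b′? (f a))
    trit-cong (no ¬a) (yes b) a′? b′? f g h k = sym (trit-2 a′? b′? (¬a ∘ g) (h b))
    trit-cong (no ¬a) (no ¬b) (yes a) _ f g h k = contradiction (g a) ¬a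
    trit-cong (no ¬a) (no ¬b) (no _) (yes b) f g h k = contradiction (k b) ¬b
    trit-cong (no ¬a) (no ¬b) (no _) (no _)  f g h k = refl

    edge : Fin m → Fin m → Fin 3
    edge u v = trit (u ~₁? v) (u ~₂? v)

    edge-symmetric : ∀ u v → edge u v ≡ edge v u
    edge-symmetric u v = trit-cong (u ~₁? v) (u ~₂? v) (v ~₁? u) (v ~₂? u) swap swap swap swap

    edge-invariant : ∀ u v → edge (s u) (s v) ≡ edge u v
    edge-invariant u v = trit-cong (s u ~₁? s v) (s u ~₂? s v) (u ~₁? v) (u ~₂? v)
      (Sum.map ⇒₁-s⁻ ⇒₁-s⁻) (Sum.map ⇒₁-s ⇒₁-s) (Sum.map ⇒₂-s⁻ ⇒₂-s⁻) (Sum.map ⇒₂-s ⇒₂-s)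

    module Automorphism (φ : LocalAut edge Moved) where
      open LocalAut φ public

      to-~₁ : ∀ {u v} → Moved u → Moved v → u ≢ v → u ~₁ v → to u ~₁ to v
      to-~₁ {u} {v} mu mv u≢v h = trit-1⁻ (to u ~₁? to v) (to u ~₂? to v)
        (trans (preserves mu mv u≢v) (trit-1 (u ~₁? v) (u ~₂? v) h))

      to-~₂ : ∀ {u v} → Moved u → Moved v → u ≢ v → u ~₂ v → to u ~₂ to v
      to-~₂ {u} {v} mu mv u≢v h = trit-2⁻ (to u ~₁? to v) (to u ~₂? to v)
        (trans (preserves mu mv u≢v) (trit-2 (u ~₁? v) (u ~₂? v) (λ k → disjoint k h) h))

    ≢-layers : ∀ {u v a b} → lev u ≡ a → lev v ≡ b → a ≢ b → u ≢ v
    ≢-layers {u} l l′ n refl = clash u l l′ n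

    adj₂ : ∀ {x u} → lev x ≡ 0 → x ~₂ u → s u ≡ p x
    adj₂ l (inj₁ (inj₁ (_ , e)))  = e
    adj₂ {x} l (inj₁ (inj₂ (l′ , _))) = clash x l l′ λ ()
    adj₂ {x} l (inj₂ (inj₁ (l′ , e))) = clash x l (skew-0 l′ e) λ ()
    adj₂ {x} l (inj₂ (inj₂ (l′ , e))) = clash x l (trans (cong lev e) (trans (lev-s _) l′)) λ ()

    adj₁₀ : ∀ {x u} → lev x ≡ 0 → lev u ≡ 0 → x ~₁ u → u ≡ s x ⊎ x ≡ s u
    adj₁₀ l l′ (inj₁ (inj₁ (_ , e))) = inj₁ e
    adj₁₀ l l′ (inj₂ (inj₁ (_ , e))) = inj₂ e
    adj₁₀ {u = u} l l′ (inj₁ (inj₂ (_ , e))) = clash u l′ (trans (cong lev e) (p-0 l)) λ ()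
    adj₁₀ {x} l l′ (inj₂ (inj₂ (k , e))) = clash x l (trans (cong lev e) (p-0 k)) λ ()

    adj₁₁ : ∀ {x u} → lev x ≡ 0 → lev u ≢ 0 → x ~₁ u → u ≡ p x
    adj₁₁ l n (inj₁ (inj₂ (_ , e))) = e
    adj₁₁ l n (inj₁ (inj₁ (_ , refl))) = contradiction (trans (lev-s _) l) n
    adj₁₁ l n (inj₂ (inj₁ (l′ , _))) = contradiction l′ n
    adj₁₁ l n (inj₂ (inj₂ (l′ , _))) = contradiction l′ n

    -- A vertex of layer 0 has a single neighbour in colour 2, whereas `y` in layer 1 has both `s y`
    -- and its predecessor `a`, distinct since `σ²` fixes nothing there.
    to-layer-0 : (φ : LocalAut edge Moved) → ∀ {x} → lev x ≡ 0 → lev (LocalAut.to φ x) ≡ 0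
    to-layer-0 φ {x} l with lev (LocalAut.to φ x) in e | top (LocalAut.to-U φ (moved-0 l))
    ... | 0 | _ = refl
    ... | suc (suc _) | s≤s ()
    ... | 1 | _ = ⊥-elim (s²-1 a₁ (trans (cong s (sym y≡sa)) sy≡a))
      where
      open Automorphism (inverse φ)
      y = LocalAut.to φ x
      a = proj₁ (s-surjective y)
      y≡sa = proj₂ (s-surjective y)
      a₁ : lev a ≡ 1
      a₁ = trans (sym (lev-s a)) (trans (cong lev (sym y≡sa)) e)
      pull : ∀ {u} → Moved u → y ≢ u → y ~₂ u → x ~₂ to u
      pull {u} mu y≢u h = subst (_~₂ to u) (to∘from x) (to-~₂ (from-U (moved-0 l)) mu y≢u h)
      sy≡a : s y ≡ a
      sy≡a = to-injective (s-injective (trans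
        (adj₂ l (pull (Moved-pow 1 (moved-1 e)) (moved-1 e ∘ sym) (inj₁ (inj₂ (e , refl)))))
        (sym (adj₂ l (pull (moved-1 a₁) (λ r → moved-1 a₁ (trans (sym y≡sa) r)) (inj₂ (inj₂ (a₁ , y≡sa))))))))

    module _ (φ : LocalAut edge Moved) where
      open Automorphism φ

      fixed-star : ∀ {x} → lev x ≡ 0 → to x ≡ x → to (s x) ≡ s x × to (p x) ≡ p x
      fixed-star {x} l e = to-s , to-p
        where
        l⁺ = trans (lev-s x) l
        to-p : to (p x) ≡ p x
        to-p = adj₁₁ l (λ k → clash (p x) (p-0 l) (trans (cong lev (sym (from∘to (p x)))) (to-layer-0 (inverse φ) k)) λ ())
          (subst (_~₁ to (p x)) e (to-~₁ (moved-0 l) (moved-1 (p-0 l)) (≢-layers l (p-0 l) λ ()) (inj₁ (inj₂ (l , refl)))))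
        to-s : to (s x) ≡ s x
        to-s with adj₁₀ l (to-layer-0 φ l⁺)
                    (subst (_~₁ to (s x)) e (to-~₁ (moved-0 l) (moved-0 l⁺) (moved-0 l ∘ sym) (inj₁ (inj₁ (l , refl)))))
        ... | inj₁ q = q
        -- `s x` is joined to `p x` in colour 2; the predecessor of `x` is joined in that colour to
        -- `σ⁻² (p x)`.
        ... | inj₂ q = contradiction
                (trans (cong s (adj₂ (to-layer-0 φ l⁺) skewed)) (trans (sym (p-s _)) (cong p (sym q)))) (s²-1 (p-0 l))
          where
          skewed : to (s x) ~₂ p x
          skewed = subst (to (s x) ~₂_) to-p (to-~₂ (moved-0 l⁺) (moved-1 (p-0 l)) (≢-layers l⁺ (p-0 l) λ ())
                     (inj₁ (inj₁ (l⁺ , sym (p-s x)))))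

      fixed : ∀ {x} → lev x ≡ 0 → to x ≡ x → ∀ v → Moved v → to v ≡ v
      fixed {x} l e v mv with lev v in k | top mv
      ... | suc (suc _) | s≤s ()
      ... | 0 | _ = layer-fixed l e (λ l e → proj₁ (fixed-star l e)) k
      ... | 1 | _ with u , u₀ , refl ← preimage k =
            proj₂ (fixed-star u₀ (layer-fixed l e (λ l e → proj₁ (fixed-star l e)) u₀))

    rigid : Rigid σ 3 Moved
    rigid with x , x₀ , _ ← preimage y₀-layer =
      stabiliser⇒rigid edge edge-symmetric edge-invariant x₀ to-layer-0 fixed

-- Reflections

module Reflection {m : ℕ} {σ : Permutation′ m} {M : ℕ} (σ^N : IsIdPower σ (suc M))
                  (base : Fin m → Fin m) (coord : Fin m → ℕ)
                  (locate : ∀ v → pow σ (coord v) (base v) ≡ v)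
                  (base-s : ∀ v → base (σ ⟨$⟩ʳ v) ≡ base v) where
  open Powers σ

  pow-mod : ∀ {i j} k l → i + k * suc M ≡ j + l * suc M → ∀ x → pow σ i x ≡ pow σ j x
  pow-mod {i} {j} k l e x = begin
    pow σ i x                          ≡⟨ cong (pow σ i) (pow-*-fix k (σ^N x)) ⟨
    pow σ i (pow σ (k * suc M) x)      ≡⟨ pow-+ i (k * suc M) x ⟨
    pow σ (i + k * suc M) x            ≡⟨ cong (λ t → pow σ t x) e ⟩
    pow σ (j + l * suc M) x            ≡⟨ pow-+ j (l * suc M) x ⟩
    pow σ j (pow σ (l * suc M) x)      ≡⟨ cong (pow σ j) (pow-*-fix l (σ^N x)) ⟩
    pow σ j x                          ∎ where open ≡-Reasoning

  base-pow : ∀ i v → base (pow σ i v) ≡ base v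
  base-pow zero    v = refl
  base-pow (suc i) v = trans (base-s _) (base-pow i v)

  base-base : ∀ v → base (base v) ≡ base v
  base-base v = trans (sym (base-pow (coord v) (base v))) (cong base (locate v))

  -- Since M ≡ -1 modulo the order of σ, the reflection maps σⁱ a to σ^(shift a - i) a
  -- for every base point a.
  module _ (shift : Fin m → ℕ) where

    reflect : Fin m → Fin m
    reflect v = pow σ (shift (base v) + M * coord v) (base v)

    reflect-pow : ∀ {a} → base a ≡ a → ∀ i → reflect (pow σ i a) ≡ pow σ (shift a + M * i) a
    reflect-pow {a} ba i with base (pow σ i a) | trans (base-pow i a) ba | locate (pow σ i a)
    ... | _ | refl | e = trans (pow-+ (shift a) _ a)
                           (trans (cong (pow σ (shift a)) (pow-*-cong M e)) (sym (pow-+ (shift a) (M * i) a)))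

    reflect-involutive : ∀ v → reflect (reflect v) ≡ v
    reflect-involutive v = begin
      reflect (pow σ (A + M * i) a)       ≡⟨ reflect-pow (base-base v) (A + M * i) ⟩
      pow σ (A + M * (A + M * i)) a       ≡⟨ pow-mod i (A + M * i) (arith A M i) a ⟩
      pow σ i a                           ≡⟨ locate v ⟩
      v                                   ∎
      where
      open ≡-Reasoning
      a = base v
      A = shift a
      i = coord v
      arith : ∀ A M i → A + M * (A + M * i) + i * suc M ≡ i + (A + M * i) * suc M
      arith = solve-∀

    reflection : Permutation′ m
    reflection = permutation reflect reflect reflect-involutive reflect-involutive

    module _ {C : Set} {e : Fin m → Fin m → C}
             (e-sym : ∀ u v → e u v ≡ e v u) (e-s : ∀ u v → e (s u) (s v) ≡ e u v) where

      -- By invariance the colours between two orbits are a function of the difference `d` of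
      -- exponents; this is the symmetry of that function under the reflection.
      Reflectable : Fin m → Fin m → Set
      Reflectable a b = ∀ d → e (pow σ (shift a) a) (pow σ (shift b + M * d) b) ≡ e a (pow σ d b)

      module _ (reflectable : ∀ {a b} → base a ≡ a → base b ≡ b → a ≢ b → Reflectable a b ⊎ Reflectable b a) where

        translate : ∀ t {i j a b} → e (pow σ i a) (pow σ j b) ≡ e (pow σ (t + i) a) (pow σ (t + j) b)
        translate t {i} {j} {a} {b} = trans (sym (pow-invariant e-s t _ _)) (cong₂ e (sym (pow-+ t i a)) (sym (pow-+ t j b)))

        -- Translating by `i` brings the reflected pair to the exponents `shift a` and
        -- `shift b − (j − i)`, where the hypothesis applies.
        reflect-distinct : ∀ {a b} i j → Reflectable a b →
          e (pow σ (shift a + M * i) a) (pow σ (shift b + M * j) b) ≡ e (pow σ i a) (pow σ j b)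
        reflect-distinct {a} {b} i j r = begin
          e (pow σ (A + M * i) a) (pow σ (B + M * j) b)             ≡⟨ translate i ⟩
          e (pow σ (i + (A + M * i)) a) (pow σ (i + (B + M * j)) b) ≡⟨ cong₂ e (pow-mod 0 i (arith₁ A M i) a) (pow-mod (M * i) i (arith₂ B M i j) b) ⟩
          e (pow σ A a) (pow σ (B + M * (j + M * i)) b)             ≡⟨ r (j + M * i) ⟩
          e a (pow σ (j + M * i) b)                                 ≡⟨ translate i {0} ⟩
          e (pow σ (i + 0) a) (pow σ (i + (j + M * i)) b)           ≡⟨ cong₂ e (cong (λ t → pow σ t a) (+-identityʳ i)) (pow-mod 0 i (arith₃ M i j) b) ⟩
          e (pow σ i a) (pow σ j b)                                 ∎
          where
          open ≡-Reasoning
          A = shift a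
          B = shift b
          arith₁ : ∀ A M i → i + (A + M * i) + 0 ≡ A + i * suc M
          arith₁ = solve-∀
          arith₂ : ∀ B M i j → i + (B + M * j) + M * i * suc M ≡ B + M * (j + M * i) + i * suc M
          arith₂ = solve-∀
          arith₃ : ∀ M i j → i + (j + M * i) + 0 ≡ j + i * suc M
          arith₃ = solve-∀

        -- Translating by `i + j − shift a` turns the reflected pair into the original one in
        -- reverse order, and colours are symmetric.
        reflect-same : ∀ a i j →
          e (pow σ (shift a + M * i) a) (pow σ (shift a + M * j) a) ≡ e (pow σ i a) (pow σ j a)
        reflect-same a i j = begin
          e (pow σ (A + M * i) a) (pow σ (A + M * j) a)                         ≡⟨ translate t ⟩
          e (pow σ (t + (A + M * i)) a) (pow σ (t + (A + M * j)) a)             ≡⟨ cong₂ e (pow-mod 0 (A + i) (arith₁ A M i j) a) (pow-mod 0 (A + j) (arith₂ A M i j) a) ⟩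
          e (pow σ j a) (pow σ i a)                                             ≡⟨ e-sym _ _ ⟩
          e (pow σ i a) (pow σ j a)                                             ∎
          where
          open ≡-Reasoning
          A = shift a
          t = M * A + i + j
          arith₁ : ∀ A M i j → M * A + i + j + (A + M * i) + 0 ≡ j + (A + i) * suc M
          arith₁ = solve-∀
          arith₂ : ∀ A M i j → M * A + i + j + (A + M * j) + 0 ≡ i + (A + j) * suc M
          arith₂ = solve-∀

        reflect-preserves : ∀ u v → e (reflect u) (reflect v) ≡ e u v
        reflect-preserves u v with base u Fin.≟ base v
        ... | yes q = trans (cong₂ e refl (cong (λ b → pow σ (shift b + M * coord v) b) (sym q)))
                        (trans (reflect-same (base u) (coord u) (coord v))
                               (cong₂ e (locate u) (trans (cong (pow σ (coord v)) q) (locate v))))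
        ... | no n with reflectable (base-base u) (base-base v) n
        ...   | inj₁ r = trans (reflect-distinct (coord u) (coord v) r) (cong₂ e (locate u) (locate v))
        ...   | inj₂ r = trans (e-sym _ _) (trans (reflect-distinct (coord v) (coord u) r)
                           (trans (cong₂ e (locate v) (locate u)) (e-sym v u)))

    -- A power of `σ` that fixes `x` also fixes `s x`, but the reflection sends `s x` to `σ⁻¹ x`.
    reflection-∉ : ∀ {x} → base x ≡ x → shift x ≡ 0 → s (s x) ≢ x → ¬ ⟨ σ ⟩ reflection
    reflection-∉ {x} bx sx s²x (t , eq) = s²x (trans (cong s (sym pow-M)) (σ^N x))
      where
      on-orbit : ∀ i → pow σ t (pow σ i x) ≡ pow σ (M * i) x
      on-orbit i = trans (sym (eq (pow σ i x))) (trans (reflect-pow bx i) (cong (λ A → pow σ (A + M * i) x) sx))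
      pow-M : pow σ M x ≡ s x
      pow-M = begin
        pow σ M x          ≡⟨ cong (λ i → pow σ i x) (*-identityʳ M) ⟨
        pow σ (M * 1) x    ≡⟨ on-orbit 1 ⟨
        pow σ t (s x)      ≡⟨ pow-comm t 1 x ⟩
        s (pow σ t x)      ≡⟨ cong s (trans (on-orbit 0) (cong (λ i → pow σ i x) (*-zeroʳ M))) ⟩
        s x                ∎ where open ≡-Reasoning

  module _ {k : ℕ} (G : ColoredGraph k m) (σ-aut : IsAut G σ) where

    -- The colouring, with the junk values on the diagonal discarded.
    e : Fin m → Fin m → Maybe (Fin k)
    e u v with u Fin.≟ v
    ... | yes _ = nothing
    ... | no  _ = just (E G u v)

    e-≢ : ∀ {u v} → u ≢ v → e u v ≡ just (E G u v)
    e-≢ {u} {v} n with u Fin.≟ v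
    ... | yes q = contradiction q n
    ... | no  _ = refl

    e-≡ : ∀ u → e u u ≡ nothing
    e-≡ u with u Fin.≟ u
    ... | yes _ = refl
    ... | no n  = contradiction refl n

    e-sym : ∀ u v → e u v ≡ e v u
    e-sym u v with u Fin.≟ v
    ... | yes refl = sym (e-≡ u)
    ... | no n     = sym (trans (e-≢ (n ∘ sym)) (cong just (symm G v u)))

    e-s : ∀ u v → e (s u) (s v) ≡ e u v
    e-s u v with u Fin.≟ v
    ... | yes refl = e-≡ (s u)
    ... | no n     = trans (e-≢ (n ∘ s-injective)) (cong just (σ-aut u v n))

    preserves⇒aut : (π : Permutation′ m) → (∀ u v → e (π ⟨$⟩ʳ u) (π ⟨$⟩ʳ v) ≡ e u v) → IsAut G π
    preserves⇒aut π h u v n = just-injective (trans (sym (e-≢ (n ∘ Powers.s-injective π)))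
                                                    (trans (h u v) (e-≢ n)))

    -- With all shifts 0, the reflection is the identity on orbits of size at most 2. Colours
    -- towards such an orbit depend on the parity of the exponent only, which `i ↦ −i` preserves.
    one-big-orbit : ∀ {x} → base x ≡ x → s (s x) ≢ x → (∀ v → base v ≢ x → s (s v) ≡ v) →
                    ¬ IsAutGroupOf ⟨ σ ⟩ G
    one-big-orbit {x} bx s²x small aut =
      reflection-∉ (λ _ → 0) bx refl s²x (proj₂ (aut π) (preserves⇒aut π
        (reflect-preserves (λ _ → 0) e-sym e-s reflectable)))
      where
      π = reflection (λ _ → 0)
      double : ∀ {b} → s (s b) ≡ b → ∀ d → pow σ (d * 2) b ≡ b
      double q d = pow-*-fix d q
      arith : ∀ M d → d * 2 + M * d + 0 ≡ d + d * suc M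
      arith = solve-∀
      -- Translating by `2d` fixes `a` and takes the exponent `−d` to `d`.
      fixˡ : ∀ {a b} → s (s a) ≡ a → ∀ d → e a (pow σ (M * d) b) ≡ e a (pow σ d b)
      fixˡ {a} {b} q d = begin
        e a (pow σ (M * d) b)                          ≡⟨ pow-invariant e-s (d * 2) _ _ ⟨
        e (pow σ (d * 2) a) (pow σ (d * 2) (pow σ (M * d) b))
          ≡⟨ cong₂ e (double q d) (trans (sym (pow-+ (d * 2) (M * d) b)) (pow-mod 0 d (arith M d) b)) ⟩
        e a (pow σ d b)                                ∎ where open ≡-Reasoning
      fixʳ : ∀ {a b} → s (s b) ≡ b → ∀ d → e a (pow σ (M * d) b) ≡ e a (pow σ d b)
      fixʳ {a} {b} q d = cong (e a) (begin
        pow σ (M * d) b                     ≡⟨ cong (pow σ (M * d)) (double q d) ⟨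
        pow σ (M * d) (pow σ (d * 2) b)     ≡⟨ pow-comm (M * d) (d * 2) b ⟩
        pow σ (d * 2) (pow σ (M * d) b)     ≡⟨ pow-+ (d * 2) (M * d) b ⟨
        pow σ (d * 2 + M * d) b             ≡⟨ pow-mod 0 d (arith M d) b ⟩
        pow σ d b                           ∎) where open ≡-Reasoning
      reflectable : ∀ {a b} → base a ≡ a → base b ≡ b → a ≢ b →
                    Reflectable (λ _ → 0) e-sym e-s a b ⊎ Reflectable (λ _ → 0) e-sym e-s b a
      reflectable {a} {b} ba bb a≢b with a Fin.≟ x
      ... | no a≢x    = inj₁ (fixˡ (small a (λ q → a≢x (trans (sym ba) q))))
      ... | yes refl  = inj₁ (fixʳ (small b (λ q → a≢b (sym (trans (sym bb) q)))))

  module _ {A : Set} {F : ℕ → A} (F-4 : ∀ d → F (4 + d) ≡ F d) where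

    F-mod : ∀ k i → F (i + k * 4) ≡ F i
    F-mod zero    i = cong F (+-identityʳ i)
    F-mod (suc k) i = trans (cong F (trans (cong (i +_) refl) (arith i (k * 4)))) (trans (F-4 _) (F-mod k i))
      where
      arith : ∀ i j → i + (4 + j) ≡ 4 + (i + j)
      arith = solve-∀

    -- The factor 3 stands for -1 modulo 4, so four residues are to be compared.
    axis-from : ∀ c → F c ≡ F 0 → F (c + 3) ≡ F 1 → F (c + 6) ≡ F 2 → F (c + 9) ≡ F 3 →
                ∀ d → F (c + 3 * d) ≡ F d
    axis-from c e₀ e₁ e₂ e₃ 0 = trans (cong F (+-identityʳ c)) e₀
    axis-from c e₀ e₁ e₂ e₃ 1 = e₁
    axis-from c e₀ e₁ e₂ e₃ 2 = e₂
    axis-from c e₀ e₁ e₂ e₃ 3 = e₃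
    axis-from c e₀ e₁ e₂ e₃ (suc (suc (suc (suc d)))) = begin
      F (c + 3 * (4 + d))   ≡⟨ cong F (arith c d) ⟩
      F (c + 3 * d + 3 * 4) ≡⟨ F-mod 3 (c + 3 * d) ⟩
      F (c + 3 * d)         ≡⟨ axis-from c e₀ e₁ e₂ e₃ d ⟩
      F d                   ≡⟨ F-4 d ⟨
      F (4 + d)             ∎
      where
      open ≡-Reasoning
      arith : ∀ c d → c + 3 * (4 + d) ≡ c + 3 * d + 3 * 4
      arith = solve-∀

    -- The reflection `d ↦ c − d` exchanges only 1 and 3 for `c = 0`, and only 0 and 2 for `c = 2`.
    -- If `F` separates both pairs, having at most two values it agrees on 0, 1 and on 2, 3, or on
    -- 0, 3 and on 1, 2; these are the axes `c = 1` and `c = 3`.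
    axis : DecidableEquality A → (∀ i j k → F j ≢ F i → F k ≢ F i → F j ≡ F k) →
           ∃ λ c → ∀ d → F (c + 3 * d) ≡ F d
    axis _≟_ two-valued with F 1 ≟ F 3 | F 0 ≟ F 2 | F 0 ≟ F 1
    ... | yes q₁₃ | _       | _       = 0 , axis-from 0 refl (sym q₁₃) (F-4 2) (trans (F-mod 2 1) q₁₃)
    ... | no _    | yes q₀₂ | _       = 2 , axis-from 2 (sym q₀₂) (F-4 1) (trans (F-mod 2 0) q₀₂) (F-mod 2 3)
    ... | no n₁₃  | no n₀₂  | yes q₀₁ = 1 , axis-from 1 (sym q₀₁) (trans (F-4 0) q₀₁) (trans (F-4 3) (sym q₂₃)) (trans (F-mod 2 2) q₂₃)
      where q₂₃ = two-valued 1 2 3 (λ q → n₀₂ (trans q₀₁ (sym q))) (n₁₃ ∘ sym)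
    ... | no n₁₃  | no n₀₂  | no n₀₁  = 3 , axis-from 3 (sym q₀₃) (trans (F-4 2) (sym q₁₂)) (trans (F-mod 2 1) q₁₂) (trans (F-mod 3 0) q₀₃)
      where
      q₀₃ = two-valued 1 0 3 n₀₁ (n₁₃ ∘ sym)
      q₁₂ = two-valued 0 1 2 (n₀₁ ∘ sym) (n₀₂ ∘ sym)

  module _ (G : ColoredGraph 2 m) (σ-aut : IsAut G σ) where

    -- The colours between the two orbits depend on a difference modulo 4 and take at most two
    -- values, so they have an axis `c`. Shifting by `c` on the orbit of `y` and by 0 elsewhere
    -- yields a reflection that preserves them; all other orbits are points.
    two-big-orbits : ∀ {x y} → base x ≡ x → base y ≡ y → x ≢ y → s (s x) ≢ x → pow σ 4 y ≡ y →
                     (∀ v → base v ≢ x → base v ≢ y → s v ≡ v) → ∀ {q} → suc M ≡ q * 4 → ¬ IsAutGroupOf ⟨ σ ⟩ G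
    two-big-orbits {x} {y} bx by x≢y s²x s⁴y small {q} N≡ aut =
      reflection-∉ shift bx (shift-≢ x≢y) s²x (proj₂ (aut π) (preserves⇒aut G σ-aut π
        (reflect-preserves shift (e-sym G σ-aut) (e-s G σ-aut) reflectable)))
      where
      open ≡-Reasoning
      f : Fin m → Fin m → Maybe (Fin 2)
      f = e G σ-aut

      F : ℕ → Maybe (Fin 2)
      F d = f x (pow σ d y)

      F-4 : ∀ d → F (4 + d) ≡ F d
      F-4 d = cong (f x) (trans (pow-comm 4 d y) (cong (pow σ d) s⁴y))

      x≢yᵢ : ∀ d → x ≢ pow σ d y
      x≢yᵢ d r = x≢y (trans (sym bx) (trans (cong base r) (trans (base-pow d y) by)))

      third : {a b c : Fin 2} → b ≢ a → c ≢ a → b ≡ c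
      third {zero}     {zero}     b≢ _ = contradiction refl b≢
      third {suc zero} {suc zero} b≢ _ = contradiction refl b≢
      third {zero}     {suc zero} {zero} _ c≢ = contradiction refl c≢
      third {zero}     {suc zero} {suc zero} _ _ = refl
      third {suc zero} {zero} {zero} _ _ = refl
      third {suc zero} {zero} {suc zero} _ c≢ = contradiction refl c≢

      two-valued : ∀ i j k → F j ≢ F i → F k ≢ F i → F j ≡ F k
      two-valued i j k with F i | e-≢ G σ-aut (x≢yᵢ i) | F j | e-≢ G σ-aut (x≢yᵢ j) | F k | e-≢ G σ-aut (x≢yᵢ k)
      ... | _ | refl | _ | refl | _ | refl = λ n n′ → cong just (third (n ∘ cong just) (n′ ∘ cong just))

      c-axis : ∃ λ c → ∀ d → F (c + 3 * d) ≡ F d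
      c-axis = axis F-4 (≡-dec Fin._≟_) two-valued

      c : ℕ
      c = proj₁ c-axis

      shift : Fin m → ℕ
      shift v = if does (v Fin.≟ y) then c else 0

      shift-≢ : ∀ {v} → v ≢ y → shift v ≡ 0
      shift-≢ {v} n with v Fin.≟ y
      ... | yes r = contradiction r n
      ... | no _  = refl

      shift-y : shift y ≡ c
      shift-y with y Fin.≟ y
      ... | yes _ = refl
      ... | no n  = contradiction refl n

      π = reflection shift

      fixed-reflectable : ∀ {a b} → s b ≡ b → Reflectable shift (e-sym G σ-aut) (e-s G σ-aut) a b
      fixed-reflectable {a} {b} r d = begin
        f (pow σ (shift a) a) (pow σ (shift b + M * d) b)  ≡⟨ cong (f _) (trans (fixed-pow r (shift b + M * d)) (sym (fixed-pow r (shift a)))) ⟩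
        f (pow σ (shift a) a) (pow σ (shift a) b)          ≡⟨ pow-invariant (e-s G σ-aut) (shift a) a b ⟩
        f a b                                              ≡⟨ cong (f a) (fixed-pow r d) ⟨
        f a (pow σ d b)                                    ∎

      -- Since 4 divides `suc M`, the exponents `M * d` and `3 * d` agree modulo 4.
      arith : ∀ c d M q → suc M ≡ q * 4 → c + M * d + d * 4 ≡ c + 3 * d + q * d * 4
      arith c d M q N≡ = begin
        c + M * d + d * 4       ≡⟨ arith₁ c d M ⟩
        c + 3 * d + suc M * d   ≡⟨ cong (λ N → c + 3 * d + N * d) N≡ ⟩
        c + 3 * d + q * 4 * d   ≡⟨ arith₂ c d q ⟩
        c + 3 * d + q * d * 4   ∎
        where
        arith₁ : ∀ c d M → c + M * d + d * 4 ≡ c + 3 * d + suc M * d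
        arith₁ = solve-∀
        arith₂ : ∀ c d q → c + 3 * d + q * 4 * d ≡ c + 3 * d + q * d * 4
        arith₂ = solve-∀

      xy-reflectable : Reflectable shift (e-sym G σ-aut) (e-s G σ-aut) x y
      xy-reflectable d = begin
        f (pow σ (shift x) x) (pow σ (shift y + M * d) y) ≡⟨ cong₂ (λ i j → f (pow σ i x) (pow σ (j + M * d) y)) (shift-≢ x≢y) shift-y ⟩
        F (c + M * d)             ≡⟨ F-mod F-4 d (c + M * d) ⟨
        F (c + M * d + d * 4)     ≡⟨ cong F (arith c d M q N≡) ⟩
        F (c + 3 * d + q * d * 4) ≡⟨ F-mod F-4 (q * d) (c + 3 * d) ⟩
        F (c + 3 * d)             ≡⟨ proj₂ c-axis d ⟩
        F d                       ∎

      reflectable : ∀ {a b} → base a ≡ a → base b ≡ b → a ≢ b →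
                    Reflectable shift (e-sym G σ-aut) (e-s G σ-aut) a b ⊎ Reflectable shift (e-sym G σ-aut) (e-s G σ-aut) b a
      reflectable {a} {b} ba bb a≢b = split (a Fin.≟ x) (a Fin.≟ y) (b Fin.≟ x) (b Fin.≟ y)
        where
        split : Dec (a ≡ x) → Dec (a ≡ y) → Dec (b ≡ x) → Dec (b ≡ y) →
                Reflectable shift (e-sym G σ-aut) (e-s G σ-aut) a b ⊎ Reflectable shift (e-sym G σ-aut) (e-s G σ-aut) b a
        split (yes refl) _          _          (yes refl) = inj₁ xy-reflectable
        split _          (yes refl) (yes refl) _          = inj₂ xy-reflectable
        split (no na)    (no na′)   _          _          = inj₂ (fixed-reflectable (small a (na ∘ trans (sym ba)) (na′ ∘ trans (sym ba))))
        split _          _          (no nb)    (no nb′)   = inj₁ (fixed-reflectable (small b (nb ∘ trans (sym bb)) (nb′ ∘ trans (sym bb))))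
        split (yes refl) _          (yes refl) _          = contradiction refl a≢b
        split _          (yes refl) _          (yes refl) = contradiction refl a≢b

-- The list of orbits

T-does⁺ : {A : Set} (a? : Dec A) → A → T (does a?)
T-does⁺ (yes _) _ = _
T-does⁺ (no n)  a = contradiction a n

T-does⁻ : {A : Set} (a? : Dec A) → T (does a?) → A
T-does⁻ (yes a) _ = a

odd⇒coprime-2 : ∀ {d} → ¬ 2 ∣ d → Coprime d 2
odd⇒coprime-2 odd (c∣d , c∣2) with prime⇒irreducible prime[2] c∣2
... | inj₁ c≡1  = c≡1
... | inj₂ refl = contradiction c∣d odd

divisor-of-2^ : ∀ n {d} → d ∣ 2 ^ n → ∃ λ e → e ≤ n × d ≡ 2 ^ e
divisor-of-2^ zero    d∣ = 0 , z≤n , ∣1⇒≡1 d∣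
divisor-of-2^ (suc n) {d} d∣ with 2 ∣? d
... | yes (divides q refl) with e , e≤n , refl ← divisor-of-2^ n {q} (*-cancelʳ-∣ 2 (subst (q * 2 ∣_) (*-comm 2 (2 ^ n)) d∣)) =
  suc e , s≤s e≤n , *-comm q 2
... | no odd with e , e≤n , q ← divisor-of-2^ n {d} (coprime-divisor (odd⇒coprime-2 odd) d∣) = e , m≤n⇒m≤1+n e≤n , q

2^-injective : ∀ {i j} → 2 ^ i ≡ 2 ^ j → i ≡ j
2^-injective {i} {j} q with <-cmp i j
... | tri< i<j _ _ = contradiction q (<⇒≢ (^-monoʳ-< 2 (s<s z<s) i<j))
... | tri≈ _ i≡j _ = i≡j
... | tri> _ _ j<i = contradiction (sym q) (<⇒≢ (^-monoʳ-< 2 (s<s z<s) j<i))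

2^-∣ : ∀ {i j} → i ≤ j → 2 ^ i ∣ 2 ^ j
2^-∣ {i} {j} i≤j = divides (2 ^ (j ∸ i)) (trans (cong (2 ^_) (sym (m∸n+n≡m i≤j))) (^-distribˡ-+-* 2 (j ∸ i) i))

least : {P : ℕ → Set} → Decidable P → ∀ b → P b → ∃ λ k → P k × (∀ {i} → i < k → ¬ P i)
least {P} P? b pb = go b (<-wellFounded b) pb
  where
  go : ∀ b → Acc _<_ b → P b → ∃ λ k → P k × (∀ {i} → i < k → ¬ P i)
  go b (acc rec) pb with anyUpTo? P? b
  ... | yes (i , i<b , pi) = go i (rec i<b) pi
  ... | no none            = b , pb , λ i<b pi → none (_ , i<b , pi)

module Orbits {m : ℕ} (σ : Permutation′ m) (n : ℕ) (σ^N : IsIdPower σ (2 ^ n)) where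
  open Powers σ

  N : ℕ
  N = 2 ^ n

  instance
    N-nonZero : NonZero N
    N-nonZero = m^n≢0 2 n

  unresidue : ∀ {d y} → pow σ d y ≡ y → ∀ a b → d ∣ ∣ a - b ∣ → pow σ a y ≡ pow σ b y
  unresidue {d} {y} e zero    b       (divides q refl) = sym (pow-*-fix q e)
  unresidue {d} {y} e (suc a) zero    (divides q r)    = trans (cong (λ t → pow σ t y) r) (pow-*-fix q e)
  unresidue {d} {y} e (suc a) (suc b) d∣               = cong s (unresidue e a b d∣)

  pow-% : ∀ {d} .{{_ : NonZero d}} {x} → pow σ d x ≡ x → ∀ k → pow σ (k % d) x ≡ pow σ k x
  pow-% {d} {x} e k = begin
    pow σ (k % d) x                             ≡⟨ cong (pow σ (k % d)) (pow-*-fix (k / d) e) ⟨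
    pow σ (k % d) (pow σ (k / d * d) x)         ≡⟨ pow-+ (k % d) (k / d * d) x ⟨
    pow σ (k % d + k / d * d) x                 ≡⟨ cong (λ t → pow σ t x) (m≡m%n+[m/n]*n k d) ⟨
    pow σ k x                                   ∎ where open ≡-Reasoning

  Same : Fin m → Fin m → Set
  Same u v = ∃ λ j → pow σ j u ≡ v

  same-sym : ∀ {u v} → Same u v → Same v u
  same-sym {u} (j , refl) = j * pred N , (begin
    pow σ (j * pred N) (pow σ j u) ≡⟨ pow-+ (j * pred N) j u ⟨
    pow σ (j * pred N + j) u       ≡⟨ cong (λ t → pow σ t u) (trans (+-comm _ j) (trans (sym (*-suc j (pred N))) (cong (j *_) (suc-pred N)))) ⟩
    pow σ (j * N) u                ≡⟨ pow-*-fix j (σ^N u) ⟩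
    u                              ∎) where open ≡-Reasoning

  same-trans : ∀ {u v w} → Same u v → Same v w → Same u w
  same-trans {u} (i , refl) (j , refl) = j + i , pow-+ j i u

  inOrbit⁺ : ∀ {x y} → Same x y → T (inOrbitᵇ N σ x y)
  inOrbit⁺ {x} {y} (j , e) = any⁺ _ (lose (∈-upTo⁺ (m%n<n j N)) (T-does⁺ (pow σ (j % N) x Fin.≟ y) (trans (pow-% (σ^N x) j) e)))

  inOrbit⁻ : ∀ {x y} → T (inOrbitᵇ N σ x y) → Same x y
  inOrbit⁻ {x} {y} t with j , _ , h ← find (any⁻ _ (upTo N) t) = j , T-does⁻ (pow σ j x Fin.≟ y) h

  ∈-orbit⁺ : ∀ {x y} → Same x y → y ∈ orbit N σ x
  ∈-orbit⁺ {x} h = ∈-filter⁺ (T? ∘ inOrbitᵇ N σ x) (∈-allFin _) (inOrbit⁺ h)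

  ∈-orbit⁻ : ∀ {x y} → y ∈ orbit N σ x → Same x y
  ∈-orbit⁻ {x} h = inOrbit⁻ (proj₂ (∈-filter⁻ (T? ∘ inOrbitᵇ N σ x) {xs = allFin m} h))

  period : ∀ x → ∃ λ d → NonZero d × pow σ d x ≡ x × (∀ k → pow σ k x ≡ x → d ∣ k)
  period x with least (λ k → (0 <? k) ×-dec (pow σ k x Fin.≟ x)) N (m^n>0 2 n , σ^N x)
  ... | d , (d>0 , e) , min = d , >-nonZero d>0 , e , multiple
    where
    instance _ = >-nonZero d>0
    multiple : ∀ k → pow σ k x ≡ x → d ∣ k
    multiple k q with k % d in r
    ... | zero  = m%n≡0⇒n∣m k d r
    ... | suc _ = contradiction (subst (0 <_) (sym r) z<s , trans (pow-% e k) q) (min (m%n<n k d))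

  -- The orbit and the list of the first `d` powers at `x` are duplicate-free with the same members,
  -- hence permutations of each other.
  orbit-length : ∀ {x d} .{{_ : NonZero d}} → pow σ d x ≡ x → (∀ k → pow σ k x ≡ x → d ∣ k) → length (orbit N σ x) ≡ d
  orbit-length {x} {d} e multiple = trans (↭-length (∼bag⇒↭ (unique∧set⇒bag
      (filter⁺ (T? ∘ inOrbitᵇ N σ x) (allFin⁺ m)) (applyUpTo⁺₁ f d distinct) (mk⇔ to from)))) (length-applyUpTo f d)
    where
    f : ℕ → Fin m
    f j = pow σ j x
    distinct : ∀ {i j} → i < j → j < d → f i ≢ f j
    distinct {i} {j} i<j j<d q = >⇒∤ {{≢-nonZero′}} (≤-<-trans (∣m-n∣≤m⊔n i j) (⊔-lub (<-trans i<j j<d) j<d)) (residue multiple i j q)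
      where ≢-nonZero′ = ℕ.≢-nonZero (λ r → <⇒≢ i<j (∣m-n∣≡0⇒m≡n r))
    to : ∀ {y} → y ∈ orbit N σ x → y ∈ applyUpTo f d
    to h with k , refl ← ∈-orbit⁻ h = subst (_∈ applyUpTo f d) (pow-% e k) (∈-applyUpTo⁺ f (m%n<n k d))
    from : ∀ {y} → y ∈ applyUpTo f d → y ∈ orbit N σ x
    from h with k , _ , refl ← ∈-applyUpTo⁻ f h = ∈-orbit⁺ (k , refl)

  abstract
    exponent : ∀ x → ∃ λ e → e ≤ n × length (orbit N σ x) ≡ 2 ^ e × pow σ (2 ^ e) x ≡ x × (∀ k → pow σ k x ≡ x → 2 ^ e ∣ k)
    exponent x with d , nz , e , multiple ← period x with i , i≤n , refl ← divisor-of-2^ n (multiple N (σ^N x)) =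
      i , i≤n , orbit-length {{nz}} e multiple , e , multiple

  ex : Fin m → ℕ
  ex x = proj₁ (exponent x)

  ex≤n : ∀ x → ex x ≤ n
  ex≤n x = proj₁ (proj₂ (exponent x))

  length-orbit : ∀ x → length (orbit N σ x) ≡ 2 ^ ex x
  length-orbit x = proj₁ (proj₂ (proj₂ (exponent x)))

  pow-ex : ∀ x → pow σ (2 ^ ex x) x ≡ x
  pow-ex x = proj₁ (proj₂ (proj₂ (proj₂ (exponent x))))

  ex-∣ : ∀ x k → pow σ k x ≡ x → 2 ^ ex x ∣ k
  ex-∣ x = proj₂ (proj₂ (proj₂ (proj₂ (exponent x))))

  pow-fixes : ∀ {x i} → ex x ≤ i → pow σ (2 ^ i) x ≡ x
  pow-fixes {x} {i} h with divides q r ← 2^-∣ h = trans (cong (λ t → pow σ t x) r) (pow-*-fix q (pow-ex x))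

  IsRep : Fin m → Set
  IsRep x = T (isRepᵇ N σ x)

  isRep⁺ : ∀ {x} → (∀ y → Same x y → toℕ x ≤ toℕ y) → IsRep x
  isRep⁺ {x} h = all⁻ _ (All.tabulate (λ {y} y∈ → ≤⇒≤ᵇ (h y (∈-orbit⁻ y∈))))

  isRep⁻ : ∀ {x} → IsRep x → ∀ y → Same x y → toℕ x ≤ toℕ y
  isRep⁻ {x} h y q = ≤ᵇ⇒≤ _ _ (All.lookup (all⁺ _ (orbit N σ x) h) (∈-orbit⁺ q))

  representative : ∀ v → ∃ λ r → Same r v × IsRep r
  representative v = go v (<-wellFounded (toℕ v))
    where
    go : ∀ v → Acc _<_ (toℕ v) → ∃ λ r → Same r v × IsRep r
    go v (acc rec) with Fin.any? (λ y → T? (inOrbitᵇ N σ v y) ×-dec (toℕ y <? toℕ v))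
    ... | no none = v , (0 , refl) , isRep⁺ (λ y q → ≮⇒≥ (λ y<v → none (y , inOrbit⁺ q , y<v)))
    ... | yes (y , t , y<v) with r , q , rep ← go y (rec y<v) = r , same-trans q (same-sym (inOrbit⁻ t)) , rep

  reps : List (Fin m)
  reps = filterᵇ (isRepᵇ N σ) (allFin m)

  reps-cover : ∀ v → Any (λ r → Same r v) reps
  reps-cover v with r , q , rep ← representative v =
    lose (∈-filter⁺ (T? ∘ isRepᵇ N σ) (∈-allFin r) rep) q

  reps-distinct : AllPairs (λ a b → ¬ Same a b) reps
  reps-distinct = go (filter⁺ (T? ∘ isRepᵇ N σ) (allFin⁺ m)) (all-filter (T? ∘ isRepᵇ N σ) (allFin m))
    where
    go : ∀ {xs} → Unique xs → All IsRep xs → AllPairs (λ a b → ¬ Same a b) xs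
    go []       []         = []
    go (u ∷ us) (r ∷ rs) = All.zipWith (λ (a≢b , r′) q → a≢b (Fin.toℕ-injective
        (≤-antisym (isRep⁻ r _ q) (isRep⁻ r′ _ (same-sym q))))) (u , rs) ∷ go us rs

  count : {P : ℕ → Set} → Decidable P → List (Fin m) → ℕ
  count P? xs = length (filter (P? ∘ ex) xs)

  numOrbits≡count : ∀ i → numOrbitsOfSize N σ (2 ^ i) ≡ count (ℕ._≟ i) reps
  numOrbits≡count i = go (allFin m)
    where
    same-test : ∀ x → does (length (orbit N σ x) ℕ.≟ 2 ^ i) ≡ does (ex x ℕ.≟ i)
    same-test x = does-⇔ (mk⇔ (λ q → 2^-injective (trans (sym (length-orbit x)) q)) (λ q → trans (length-orbit x) (cong (2 ^_) q)))
                         (length (orbit N σ x) ℕ.≟ 2 ^ i) (ex x ℕ.≟ i)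
    go : ∀ xs → length (filterᵇ (λ x → isRepᵇ N σ x ∧ does (length (orbit N σ x) ℕ.≟ 2 ^ i)) xs)
                ≡ count (ℕ._≟ i) (filterᵇ (isRepᵇ N σ) xs)
    go []       = refl
    go (x ∷ xs) with isRepᵇ N σ x
    ... | false = go xs
    ... | true rewrite same-test x with does (ex x ℕ.≟ i)
    ...   | true  = cong suc (go xs)
    ...   | false = go xs

-- Sums of orbit counts

sumFromTo-cong : ∀ a b {f g : ℕ → ℕ} → (∀ i → f i ≡ g i) → sumFromTo a b f ≡ sumFromTo a b g
sumFromTo-cong a zero    h = cong (λ t → if a ≤ᵇ 0 then t else 0) (h 0)
sumFromTo-cong a (suc b) h = cong₂ (λ r t → r + (if a ≤ᵇ suc b then t else 0)) (sumFromTo-cong a b h) (h (suc b))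

sumFromTo-0 : ∀ a b → sumFromTo a b (λ _ → 0) ≡ 0
sumFromTo-0 a zero    = if-eta (a ≤ᵇ 0)
sumFromTo-0 a (suc b) = cong₂ _+_ (sumFromTo-0 a b) (if-eta (a ≤ᵇ suc b))

sumFromTo-+ : ∀ a b (f g : ℕ → ℕ) → sumFromTo a b (λ i → f i + g i) ≡ sumFromTo a b f + sumFromTo a b g
sumFromTo-+ a zero    f g with a ≤ᵇ 0
... | true  = refl
... | false = refl
sumFromTo-+ a (suc b) f g rewrite sumFromTo-+ a b f g with a ≤ᵇ suc b
... | true  = interchange +-commutativeSemigroup (sumFromTo a b f) (sumFromTo a b g) (f (suc b)) (g (suc b))
... | false = trans (+-identityʳ _) (sym (cong₂ _+_ (+-identityʳ (sumFromTo a b f)) (+-identityʳ (sumFromTo a b g))))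

indicator : ℕ → ℕ → ℕ
indicator e i = if does (e ℕ.≟ i) then 1 else 0

sum-indicator-> : ∀ a b {e} → b < e → sumFromTo a b (indicator e) ≡ 0
sum-indicator-> a zero    {e} b<e rewrite dec-false (e ℕ.≟ 0) (>⇒≢ b<e) = if-eta (a ≤ᵇ 0)
sum-indicator-> a (suc b) {e} b<e rewrite dec-false (e ℕ.≟ suc b) (>⇒≢ b<e) =
  cong₂ _+_ (sum-indicator-> a b (<-trans (n<1+n b) b<e)) (if-eta (a ≤ᵇ suc b))

sum-indicator-≤ : ∀ a b {e} → e ≤ b → sumFromTo a b (indicator e) ≡ (if does (a ≤? e) then 1 else 0)
sum-indicator-≤ a zero    {zero} e≤b = refl
sum-indicator-≤ a (suc b) {e} e≤b with m≤n⇒m<n∨m≡n e≤b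
... | inj₁ e<b rewrite dec-false (e ℕ.≟ suc b) (<⇒≢ e<b) =
  trans (cong₂ _+_ (sum-indicator-≤ a b (ℕ.s≤s⁻¹ e<b)) (if-eta (a ≤ᵇ suc b))) (+-identityʳ _)
... | inj₂ refl rewrite dec-true (suc b ℕ.≟ suc b) refl =
  cong₂ _+_ (sum-indicator-> a b ≤-refl) refl

-- Entry `k` of `x ∷ xs`, the last entry being repeated past the end; this makes `p` total, mapping
-- the last orbit to itself.
at : {A : Set} → A → List A → ℕ → A
at x []       _       = x
at x (y ∷ ys) zero    = x
at x (y ∷ ys) (suc k) = at y ys k

module _ {A : Set} where
  at-zero : ∀ (x : A) xs → at x xs 0 ≡ x
  at-zero x []       = refl
  at-zero x (y ∷ ys) = refl

  at-last : ∀ (x : A) xs k → length xs ≤ k → at x xs (suc k) ≡ at x xs k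
  at-last x []            k       _       = refl
  at-last x (y ∷ [])      (suc k) (s≤s h) = refl
  at-last x (y ∷ z ∷ zs)  (suc k) (s≤s h) = at-last y (z ∷ zs) k h

  All-at : ∀ {P : A → Set} {x xs} → All P (x ∷ xs) → ∀ k → P (at x xs k)
  All-at {xs = []}     (p ∷ _)  k       = p
  All-at {xs = y ∷ ys} (p ∷ _)  zero    = p
  All-at {xs = y ∷ ys} (_ ∷ ps) (suc k) = All-at ps k

  All-at-suc : ∀ {P : A → Set} {x xs} → All P xs → ∀ {k} → k < length xs → P (at x xs (suc k))
  All-at-suc {xs = y ∷ ys} ps {k} _ = All-at ps k

  AllPairs-at : ∀ {R : A → A → Set} {x xs} → AllPairs R (x ∷ xs) → ∀ {k l} → k < l → l ≤ length xs → R (at x xs k) (at x xs l)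
  AllPairs-at {xs = y ∷ ys} (r ∷ _)  {zero}  {suc l} _       _       = All-at r l
  AllPairs-at {xs = y ∷ ys} (_ ∷ rs) {suc k} {suc l} (s≤s h) (s≤s b) = AllPairs-at rs h b

  Any-at : ∀ {P : A → Set} {x xs} (q : Any P (x ∷ xs)) → P (at x xs (toℕ (index q)))
  Any-at {xs = []}     (here p)  = p
  Any-at {xs = y ∷ ys} (here p)  = p
  Any-at {xs = y ∷ ys} (there q) = Any-at q

  index≤length : ∀ {P : A → Set} {x xs} (q : Any P (x ∷ xs)) → toℕ (index q) ≤ length xs
  index≤length q = ℕ.s≤s⁻¹ (Fin.toℕ<n (index q))

-- Orbits in order of decreasing size

module OrderedOrbits {m : ℕ} (σ : Permutation′ m) (n : ℕ) (σ^N : IsIdPower σ (2 ^ n)) where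
  open Powers σ
  open Orbits σ n σ^N public

  σ^1+M : IsIdPower σ (suc (pred N))
  σ^1+M x = trans (cong (λ t → pow σ t x) (suc-pred N)) (σ^N x)

  _≽_ : Fin m → Fin m → Set
  x ≽ y = ex y ≤ ex x

  record Listing (xs : List (Fin m)) : Set where
    field
      cover      : ∀ v → Any (λ a → Same a v) xs
      distinct   : AllPairs (λ a b → ¬ Same a b) xs
      descending : AllPairs _≽_ xs

  module Indexed {x : Fin m} {xs : List (Fin m)} (l : Listing (x ∷ xs)) where
    open Listing l

    lev : Fin m → ℕ
    lev v = toℕ (index (cover v))

    base : Fin m → Fin m
    base v = at x xs (lev v)

    coord : Fin m → ℕ
    coord v = proj₁ (Any-at (cover v))

    locate : ∀ v → pow σ (coord v) (base v) ≡ v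
    locate v = proj₂ (Any-at (cover v))

    locate′ : ∀ v {k} → k ≡ lev v → pow σ (coord v) (at x xs k) ≡ v
    locate′ v refl = locate v

    lev≤ : ∀ v → lev v ≤ length xs
    lev≤ v = index≤length (cover v)

    same⇒≡ : ∀ {k l} → k ≤ length xs → l ≤ length xs → Same (at x xs k) (at x xs l) → k ≡ l
    same⇒≡ {k} {l} k≤ l≤ q with <-cmp k l
    ... | tri< k<l _ _ = contradiction q (AllPairs-at distinct k<l l≤)
    ... | tri≈ _ k≡l _ = k≡l
    ... | tri> _ _ l<k = contradiction (same-sym q) (AllPairs-at distinct l<k k≤)

    lev-at : ∀ {k} → k ≤ length xs → ∀ i → lev (pow σ i (at x xs k)) ≡ k
    lev-at {k} k≤ i = sym (same⇒≡ k≤ (lev≤ _) (same-trans (i , refl) (same-sym (coord _ , locate _))))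

    lev-s : ∀ v → lev (s v) ≡ lev v
    lev-s v = trans (cong (lev ∘ s) (sym (locate v))) (lev-at (lev≤ v) (suc (coord v)))

    base-s : ∀ v → base (s v) ≡ base v
    base-s v = cong (at x xs) (lev-s v)

    next-≽ : ∀ k → at x xs k ≽ at x xs (suc k)
    next-≽ k with k <? length xs
    ... | yes k< = AllPairs-at descending (n<1+n k) k<
    ... | no k≮  = ≤-reflexive (cong ex (at-last x xs k (≮⇒≥ k≮)))

    -- Sizes are powers of 2 and do not increase along the list, so the period of the next orbit
    -- divides that of this one. This makes `p` independent of the exponent used for a vertex.
    next-pow : ∀ k i j → pow σ i (at x xs k) ≡ pow σ j (at x xs k) → pow σ i (at x xs (suc k)) ≡ pow σ j (at x xs (suc k))
    next-pow k i j q = unresidue (pow-fixes (next-≽ k)) i j (residue (ex-∣ _) i j q)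

    p : Fin m → Fin m
    p v = pow σ (coord v) (at x xs (suc (lev v)))

    p-pow : ∀ {k} → k ≤ length xs → ∀ i → p (pow σ i (at x xs k)) ≡ pow σ i (at x xs (suc k))
    p-pow {k} k≤ i with lev (pow σ i (at x xs k)) | lev-at k≤ i | locate (pow σ i (at x xs k))
    ... | _ | refl | q = next-pow k (coord (pow σ i (at x xs k))) i q

    p-s : ∀ v → p (s v) ≡ s (p v)
    p-s v = trans (cong (p ∘ s) (sym (locate v))) (p-pow (lev≤ v) (suc (coord v)))

    layers : Layers σ
    layers = record
      { lev = lev ; p = p ; lev-s = lev-s ; p-s = p-s
      ; transitive = λ {u} {v} q → let (j , e) = same-trans (same-sym (coord u , locate u)) (coord v , locate′ v q) in j , sym e
      ; preimage = λ {v} {k} q → let k≤ = ≤-trans (n≤1+n k) (≤-trans (≤-reflexive (sym q)) (lev≤ v)) in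
          pow σ (coord v) (at x xs k) , lev-at k≤ (coord v) ,
          trans (p-pow k≤ (coord v)) (locate′ v (sym q)) }

    base-ex : ∀ {v i} → ex (base v) ≤ i → pow σ (2 ^ i) v ≡ v
    base-ex {v} {i} h = subst (λ u → pow σ (2 ^ i) u ≡ u) (locate v)
      (trans (pow-comm (2 ^ i) (coord v) (base v)) (cong (pow σ (coord v)) (pow-fixes h)))

    ex-period : ∀ {v i} → i ≤ ex (base v) → PeriodMultipleOf σ (2 ^ i) v
    ex-period {v} h k q = ∣-trans (2^-∣ h) (ex-∣ (base v) k (pow-injective (coord v)
      (trans (pow-comm (coord v) k (base v)) (trans (cong (pow σ k) (locate v)) (trans q (sym (locate v)))))))

    ex-moved : ∀ {v} → s v ≢ v → 1 ≤ ex (base v)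
    ex-moved {v} mv with ex (base v) in q
    ... | zero  = contradiction (base-ex {v} {0} (≤-reflexive q)) mv
    ... | suc _ = s≤s z≤n

    base-x : base x ≡ x
    base-x = trans (cong (at x xs) lev-x) (at-zero x xs)
      where
      lev-x : lev x ≡ 0
      lev-x = trans (cong lev (sym (at-zero x xs))) (lev-at z≤n 0)

    s²x≢x : 2 ≤ ex x → s (s x) ≢ x
    s²x≢x h q = from-no (4 ∣? 2) (∣-trans (2^-∣ h) (ex-∣ x 2 q))

    x-moved : 2 ≤ ex x → s x ≢ x
    x-moved h q = s²x≢x h (trans (cong s q) q)

    lev≢0 : ∀ {v} → base v ≢ x → ∃ λ k → lev v ≡ suc k
    lev≢0 {v} n with lev v
    ... | zero  = contradiction (at-zero x xs) n
    ... | suc k = k , refl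

    period-at : ∀ {k i} → i ≤ ex (at x xs k) → ∀ {v} → lev v ≡ k → PeriodMultipleOf σ (2 ^ i) v
    period-at h {v} refl = ex-period {v} h

  module Indexed₂ {x y : Fin m} {zs : List (Fin m)} (l : Listing (x ∷ y ∷ zs)) where
    open Indexed l

    ex-second : ex (at x (y ∷ zs) 1) ≡ ex y
    ex-second = cong ex (at-zero y zs)

    y-layer : lev (at x (y ∷ zs) 1) ≡ 1
    y-layer = lev-at (s≤s z≤n) 0

    fixed-below : All (λ z → ex z ≡ 0) zs → ∀ {v k} → lev v ≡ suc (suc k) → s v ≡ v
    fixed-below zs₀ {v} {k} q = base-ex {v} {0} (≤-reflexive (trans (cong (ex ∘ at x (y ∷ zs)) q)
      (All-at-suc zs₀ (ℕ.s≤s⁻¹ (subst (_≤ length (y ∷ zs)) q (lev≤ v))))))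

    two-moved-layers : All (λ z → ex z ≡ 0) zs → ∀ {v} → s v ≢ v → lev v ≤ 1
    two-moved-layers zs₀ {v} mv with lev v in q
    ... | 0           = z≤n
    ... | 1           = s≤s z≤n
    ... | suc (suc _) = contradiction (fixed-below zs₀ q) mv

  ⟨σ⟩∋σ : ⟨ σ ⟩ σ
  ⟨σ⟩∋σ = 1 , λ _ → refl

  module _ {P : ℕ → Set} (P? : Decidable P) where

    count-accept : ∀ {x xs} → P (ex x) → count P? (x ∷ xs) ≡ suc (count P? xs)
    count-accept px = cong length (filter-accept (P? ∘ ex) px)

    count-none : ∀ {xs} → All (¬_ ∘ P ∘ ex) xs → count P? xs ≡ 0
    count-none h = cong length (filter-none (P? ∘ ex) h)

    count≡0 : ∀ xs → count P? xs ≡ 0 → All (¬_ ∘ P ∘ ex) xs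
    count≡0 xs q = All.tabulate λ v∈ pv → contradiction (filter-some (P? ∘ ex) (lose v∈ pv)) (≤⇒≯ (≤-reflexive q))

  -- Each orbit contributes to the count for a single `i`, its exponent, and that is at most `n`.
  sum≡count : ∀ a xs → sumFromTo a n (λ i → count (ℕ._≟ i) xs) ≡ count (a ≤?_) xs
  sum≡count a []       = sumFromTo-0 a n
  sum≡count a (x ∷ xs) = begin
    sumFromTo a n (λ i → count (ℕ._≟ i) (x ∷ xs))                           ≡⟨ sumFromTo-cong a n (λ i → count-∷ (ℕ._≟ i)) ⟩
    sumFromTo a n (λ i → indicator (ex x) i + count (ℕ._≟ i) xs)            ≡⟨ sumFromTo-+ a n (indicator (ex x)) (λ i → count (ℕ._≟ i) xs) ⟩
    sumFromTo a n (indicator (ex x)) + sumFromTo a n (λ i → count (ℕ._≟ i) xs) ≡⟨ cong₂ _+_ (sum-indicator-≤ a n (ex≤n x)) (sum≡count a xs) ⟩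
    (if does (a ≤? ex x) then 1 else 0) + count (a ≤?_) xs                  ≡⟨ count-∷ (a ≤?_) ⟨
    count (a ≤?_) (x ∷ xs)                                                  ∎
    where
    open ≡-Reasoning
    count-∷ : ∀ {P : ℕ → Set} (P? : Decidable P) → count P? (x ∷ xs) ≡ (if does (P? (ex x)) then 1 else 0) + count P? xs
    count-∷ P? with does (P? (ex x))
    ... | true  = refl
    ... | false = refl

  -- The three cases

  largest-big : ∀ {x xs c} → AllPairs _≽_ (x ∷ xs) → count (2 ≤?_) (x ∷ xs) ≡ suc c → 2 ≤ ex x × count (2 ≤?_) xs ≡ c
  largest-big {x} (x≽ ∷ _) q with 2 ≤? ex x
  ... | yes h = h , suc-injective (trans (sym (count-accept (2 ≤?_) h)) q)
  ... | no n  = contradiction (trans (sym q) (count-none (2 ≤?_) (n ∷ All.map (λ z≤x h → n (≤-trans h z≤x)) x≽))) 1+n≢0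

  case-1 : ∀ xs → Listing xs → count (2 ≤?_) xs ≡ 1 → ¬ GRany ⟨ σ ⟩
  case-1 (x ∷ xs) l S (_ , G , aut) with hx , S′ ← largest-big (Listing.descending l) S =
    Reflection.one-big-orbit {M = pred N} σ^1+M base coord locate base-s G (proj₁ (aut σ) ⟨σ⟩∋σ) base-x (s²x≢x hx) small aut
    where
    open Indexed l
    small : ∀ v → base v ≢ x → s (s v) ≡ v
    small v v≢x with k , q ← lev≢0 v≢x = base-ex {v} {1} (≤-trans (≤-reflexive (cong (ex ∘ at x xs) q))
      (All-at-suc (All.map (λ n → ℕ.s≤s⁻¹ (≰⇒> n)) (count≡0 (2 ≤?_) xs S′)) (subst (_≤ length xs) q (lev≤ v))))

  case-2 : 2 ≤ n → ∀ xs → Listing xs → count (2 ≤?_) xs ≡ 2 → count (ℕ._≟ 1) xs ≡ 0 →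
           count (ℕ._≟ 2) xs ≡ 1 ⊎ count (ℕ._≟ 2) xs ≡ 2 → GR* 3 ⟨ σ ⟩
  case-2 2≤n (x ∷ []) l S _ _ = contradiction (proj₂ (largest-big (Listing.descending l) S)) λ ()
  case-2 2≤n (x ∷ y ∷ zs) l S k₁ k₂
    with hx , S′ ← largest-big (Listing.descending l) S
    with hy , S″ ← largest-big (AllPairs.tail (Listing.descending l)) S′ = positive , negative
    where
    open Listing l
    open Indexed l
    open Indexed₂ l
    zero-or : ∀ e → e ≢ 1 → ¬ 2 ≤ e → e ≡ 0
    zero-or 0             _ _ = refl
    zero-or 1             n _ = contradiction refl n
    zero-or (suc (suc e)) _ n = contradiction (s≤s (s≤s z≤n)) n
    zs₀ : All (λ z → ex z ≡ 0) zs
    zs₀ = All.zipWith (λ {z} (n₁ , n₂) → zero-or (ex z) n₁ n₂)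
            (All.tail (All.tail (count≡0 (ℕ._≟ 1) (x ∷ y ∷ zs) k₁)) , count≡0 (2 ≤?_) zs S″)
    -- Otherwise the first two orbits both have size at least 8 and the others are points, so no
    -- orbit has size 4.
    y₂ : ex y ≡ 2
    y₂ with ex y ℕ.≟ 2
    ... | yes q = q
    ... | no n  = Sum.[ absurd , absurd ]
      k₂
      where
      no-4 : count (ℕ._≟ 2) (x ∷ y ∷ zs) ≡ 0
      no-4 = count-none (ℕ._≟ 2) ((λ q → n (≤-antisym (≤-trans (All.head (AllPairs.head descending)) (≤-reflexive q)) hy))
               ∷ n ∷ All.map (λ q r → 0≢1+n (trans (sym q) r)) zs₀)
      absurd : ∀ {k} → count (ℕ._≟ 2) (x ∷ y ∷ zs) ≡ suc k → ex y ≡ 2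
      absurd q = contradiction (trans (sym no-4) q) 0≢1+n
    positive : GR 3 ⟨ σ ⟩
    positive = Extension.Moved⇒GR σ 3 (x-moved hx) {zero} {suc zero} (λ ())
      (TwoOrbitsThreeColours.rigid layers {pred N} σ^1+M
        (period-at {1} {2} (≤-reflexive (sym (trans ex-second y₂)))) y-layer (two-moved-layers zs₀))
    negative : ¬ GR 2 ⟨ σ ⟩
    negative (G , aut) with divides q N≡ ← 2^-∣ 2≤n =
      Reflection.two-big-orbits {M = pred N} σ^1+M base coord locate base-s G (proj₁ (aut σ) ⟨σ⟩∋σ) base-x
        base-y (λ { refl → All.head (AllPairs.head distinct) (0 , refl) }) (s²x≢x hx)
        (pow-fixes {y} {2} (≤-reflexive y₂)) small {q} (trans (suc-pred N) N≡) aut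
      where
      base-y : base y ≡ y
      base-y = trans (cong base (sym (at-zero y zs))) (trans (cong (at x (y ∷ zs)) y-layer) (at-zero y zs))
      small : ∀ v → base v ≢ x → base v ≢ y → s v ≡ v
      small v v≢x v≢y with lev≢0 v≢x
      ... | suc k , q = fixed-below zs₀ q
      ... | zero , q  = contradiction (trans (cong (at x (y ∷ zs)) q) (at-zero y zs)) v≢y

  -- As `σ²` is not the identity, some orbit has size at least 4; as the number of such orbits is
  -- not 1, there is a second. If a third orbit is nontrivial, `ThreeOrbits` applies; if not,
  -- failure of the conditions of case 2 forces size at least 8 on the second, as `TwoOrbits`
  -- demands.
  case-3 : ¬ IsIdPower σ 1 → ¬ IsIdPower σ 2 → ∀ xs → Listing xs → ¬ count (2 ≤?_) xs ≡ 1 →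
           ¬ (count (2 ≤?_) xs ≡ 2 × count (ℕ._≟ 1) xs ≡ 0 × (count (ℕ._≟ 2) xs ≡ 1 ⊎ count (ℕ._≟ 2) xs ≡ 2)) → GR 2 ⟨ σ ⟩
  case-3 ¬id ¬id² [] l _ _ = contradiction (λ v → case Listing.cover l v of λ ()) ¬id
  case-3 ¬id ¬id² (x ∷ xs) l S≢1 not-2 with 2 ≤? ex x
  ... | no n = contradiction (λ v → base-ex {v} {1}
                 (All-at {P = λ z → ex z ≤ 1} (x≤1 ∷ All.map (λ z≤x → ≤-trans z≤x x≤1) (AllPairs.head descending)) (lev v))) ¬id²
    where
    open Listing l
    open Indexed l
    x≤1 = ℕ.s≤s⁻¹ (≰⇒> n)
  case-3 ¬id ¬id² (x ∷ []) l S≢1 not-2 | yes hx = contradiction (count-accept (2 ≤?_) {x} {[]} hx) S≢1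
  case-3 ¬id ¬id² (x ∷ y ∷ zs) l S≢1 not-2 | yes hx with 2 ≤? ex y
  ... | no n = contradiction (trans (count-accept (2 ≤?_) hx) (cong suc (count-none (2 ≤?_)
                 (n ∷ All.map (λ z≤y h → n (≤-trans h z≤y)) (AllPairs.head (AllPairs.tail descending)))))) S≢1
    where open Listing l
  ... | yes hy = Extension.Moved⇒GR σ 2 (Indexed.x-moved l hx) {zero} {suc zero} (λ ()) (two-or-three zs l not-2)
    where
    two-or-three : ∀ zs → Listing (x ∷ y ∷ zs) →
      ¬ (count (2 ≤?_) (x ∷ y ∷ zs) ≡ 2 × count (ℕ._≟ 1) (x ∷ y ∷ zs) ≡ 0 ×
         (count (ℕ._≟ 2) (x ∷ y ∷ zs) ≡ 1 ⊎ count (ℕ._≟ 2) (x ∷ y ∷ zs) ≡ 2)) →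
      Rigid σ 2 (Extension.Moved σ 2)
    two-or-three zs l not-2 with All.all? (λ z → ex z ℕ.≟ 0) zs
    two-or-three zs l not-2 | yes zs₀ = TwoOrbits.rigid layers {pred N} σ^1+M
      (period-at {1} {3} (≤-trans y≥3 (≤-reflexive (sym ex-second)))) y-layer (two-moved-layers zs₀)
      where
      open Indexed l
      open Indexed₂ l
      ¬2≤zs : All (λ z → ¬ 2 ≤ ex z) zs
      ¬2≤zs = All.map (λ q h → <⇒≱ h (≤-trans (≤-reflexive q) z≤n)) zs₀
      4-orbits : ex y ≡ 2 → count (ℕ._≟ 2) (x ∷ y ∷ zs) ≡ 1 ⊎ count (ℕ._≟ 2) (x ∷ y ∷ zs) ≡ 2
      4-orbits y₂ with count-accept (ℕ._≟ 2) {y} {zs} y₂ | count-none (ℕ._≟ 2) {zs} (All.map (λ q r → 0≢1+n (trans (sym q) r)) zs₀) | ex x ℕ.≟ 2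
      ... | c | d | yes x₂ = inj₂ (trans (count-accept (ℕ._≟ 2) x₂) (cong suc (trans c (cong suc d))))
      ... | c | d | no x≢2 = inj₁ (trans (cong length (filter-reject ((ℕ._≟ 2) ∘ ex) x≢2)) (trans c (cong suc d)))
      y≥3 : 3 ≤ ex y
      y≥3 = ≤∧≢⇒< hy λ 2≡y → not-2
        ( trans (count-accept (2 ≤?_) hx) (cong suc (trans (count-accept (2 ≤?_) hy) (cong suc (count-none (2 ≤?_) ¬2≤zs))))
        , count-none (ℕ._≟ 1) (>⇒≢ hx ∷ >⇒≢ hy ∷ All.map (λ q r → 0≢1+n (trans (sym q) r)) zs₀)
        , 4-orbits (sym 2≡y) )
    two-or-three [] l not-2 | no n = contradiction [] n
    two-or-three (z ∷ zs) l not-2 | no n = ThreeOrbits.rigid layers {pred N} σ^1+M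
      (period-at {1} {2} hy) (λ {v} mv → ex-period {v} {1} (ex-moved mv)) z-layer z-moved
      where
      open Listing l
      open Indexed l
      z′ = at z zs 0
      z≥1 : 1 ≤ ex z
      z≥1 with ex z in q
      ... | zero  = contradiction (q ∷ All.map (λ h → n≤0⇒n≡0 (≤-trans h (≤-reflexive q))) (AllPairs.head (AllPairs.tail (AllPairs.tail descending)))) n
      ... | suc _ = s≤s z≤n
      z-layer : lev z′ ≡ 2
      z-layer = lev-at (s≤s (s≤s z≤n)) 0
      z-moved : s z′ ≢ z′
      z-moved e with at z zs 0 | at-zero z zs
      ... | _ | refl = from-no (2 ∣? 1) (∣-trans (2^-∣ z≥1) (ex-∣ z 1 e))

  -- Sorting the orbits

  size-order : DecTotalOrder _ _ _
  size-order = On.decTotalOrder (Flip.decTotalOrder ≤-decTotalOrder) ex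

  open Sort size-order using (sort; sort-↭; sort-↗)

  orbits : List (Fin m)
  orbits = sort reps

  orbits-listing : Listing orbits
  orbits-listing = record
    { cover      = λ v → Any-resp-↭ (↭-sym (sort-↭ reps)) (reps-cover v)
    ; distinct   = Permutationₛ.AllPairs-resp-↭ (setoid (Fin m)) (λ n q → n (same-sym q))
                     ((λ { refl r → r }) , (λ { refl r → r })) (↭⇒↭ₛ (↭-sym (sort-↭ reps))) reps-distinct
    ; descending = Sorted⇒AllPairs (DecTotalOrder.totalOrder size-order) (sort-↗ reps)
    }

  count-orbits : ∀ i → numOrbitsOfSize N σ (2 ^ i) ≡ count (ℕ._≟ i) orbits
  count-orbits i = trans (numOrbits≡count i) (↭-length (filter-↭ ((ℕ._≟ i) ∘ ex) (↭-sym (sort-↭ reps))))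

  count-big-orbits : sumFromTo 2 n (λ i → numOrbitsOfSize N σ (2 ^ i)) ≡ count (2 ≤?_) orbits
  count-big-orbits = trans (sumFromTo-cong 2 n count-orbits) (sum≡count 2 orbits)

theorem4p8 : (n m : ℕ) → 2 ≤ n → (σ : Permutation′ m) → CyclicOfOrder σ (2 ^ n) →
    let k : ℕ → ℕ
        k i = numOrbitsOfSize (2 ^ n) σ (2 ^ i)
        S = sumFromTo 2 n k
        A = ⟨ σ ⟩
    in (S ≡ 1 → ¬ GRany A)
       × (S ≡ 2 → k 1 ≡ 0 → (k 2 ≡ 1 ⊎ k 2 ≡ 2) → GR* 3 A)
       × (¬ S ≡ 1 → ¬ (S ≡ 2 × k 1 ≡ 0 × (k 2 ≡ 1 ⊎ k 2 ≡ 2)) → GR 2 A)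
theorem4p8 n m 2≤n σ (_ , σ^N , minimal)
  rewrite OrderedOrbits.count-big-orbits σ n σ^N | OrderedOrbits.count-orbits σ n σ^N 1 | OrderedOrbits.count-orbits σ n σ^N 2 =
    case-1 orbits orbits-listing
  , case-2 2≤n orbits orbits-listing
  , case-3 (minimal 1 (s≤s z≤n) (^-monoʳ-< 2 (s<s z<s) {0} (≤-trans (s≤s z≤n) 2≤n)))
           (minimal 2 (s≤s z≤n) (^-monoʳ-< 2 (s<s z<s) {1} 2≤n)) orbits orbits-listing
  where open OrderedOrbits σ n σ^N
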